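{- Every forest configuration is liftable over $\mathbb{C}$.
   Context: A point-line configuration is a triple $(\mathcal{P},\mathcal{L},\mathcal{I})$ with a finite set of points, a set of lines, and incidences $\mathcal{I}\subseteq\mathcal{P}\times\mathcal{L}$; a line is identified with the set of points incident to it. It is linear if any two points lie on at most one common line and every line contains at least two points; configurations here are linear. Given a total order $p_1<\dots<p_n$ on $\mathcal{P}$, the graph $G_{\mathcal{C}}$ of $\mathcal{C}=(\mathcal{P},\mathcal{L},\mathcal{I})$ has vertex set $\mathcal{P}$ and an edge $p_ip_j$ ($p_i<p_j$) whenever $p_i,p_j\in\ell$ for some line $\ell$ and no $p_k\in\ell$ satisfies $p_i<p_k<p_j$. $\mathcal{C}$ is a forest configuration if $G_{\mathcal{C}}$ is a forest (this does not depend on the chosen order). A non-degenerate realisation of a linear configuration $\mathcal{C}$ with $n$ points is an $n$-tuple of points of $\mathbb{P}^2_{\mathbb{C}}$ together with a bijection with the points of $\mathcal{C}$ such that (non-)collinear points in $\mathcal{C}$ correspond to (non-)collinear points in $\mathbb{P}^2_{\mathbb{C}}$. $\mathcal{C}$ is liftable over $\mathbb{C}$ if every $n$-tuple of distinct collinear points of $\mathbb{P}^2_{\mathbb{C}}$ (labelled by the points of $\mathcal{C}$) is the image, under projection from a point outside their line onto that line, of a non-degenerate realisation of $\mathcal{C}$. -}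

module Defs where

open import Algebra.Bundles using (CommutativeMonoid)
import Algebra.Properties.CommutativeSemigroup as CommutativeSemigroup
open import Data.Fin as Fin using (Fin; zero; suc; inject₁; fromℕ)
open import Data.Fin.Patterns using (0F; 1F; 2F)
open import Data.Fin.Subset using (Subset; ∣_∣; _∈_; _⊆_)
open import Data.Nat as ℕ using (ℕ; _⊔_)
import Data.Nat.Properties as ℕP
open import Data.Product using (_×_; _,_; ∃-syntax; Σ-syntax)
open import Data.Rational as ℚ using (ℚ; 0ℚ; 1ℚ; ½)
import Data.Rational.Properties as ℚP
open import Data.Sum using (_⊎_)
open import Function.Definitions using (Injective)
open import Relation.Binary.PropositionalEquality
  using (_≡_; _≢_; refl; sym; trans; cong; cong₂; subst)
open import Relation.Nullary using (¬_)

IsCauchy : (ℕ → ℚ) → Set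
IsCauchy x = ∀ ε → 0ℚ ℚ.< ε →
  ∃[ N ] (∀ m n → N ℕ.≤ m → N ℕ.≤ n → ℚ.∣ x m ℚ.- x n ∣ ℚ.< ε)

record ℝ : Set where
  constructor mkℝ
  field
    seq    : ℕ → ℚ
    cauchy : IsCauchy seq

open ℝ public

infix 4 _≈ᵣ_ _#ᵣ_

_≈ᵣ_ : ℝ → ℝ → Set
x ≈ᵣ y = ∀ ε → 0ℚ ℚ.< ε →
  ∃[ N ] (∀ n → N ℕ.≤ n → ℚ.∣ seq x n ℚ.- seq y n ∣ ℚ.< ε)

-- Apartness, the constructive form of inequality: x #ᵣ y implies
-- ¬ (x ≈ᵣ y), and classically the converse holds as well.
_#ᵣ_ : ℝ → ℝ → Set
x #ᵣ y = ∃[ ε ] (0ℚ ℚ.< ε ×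
  ∃[ N ] (∀ n → N ℕ.≤ n → ε ℚ.≤ ℚ.∣ seq x n ℚ.- seq y n ∣))

private
  open CommutativeSemigroup
    (CommutativeMonoid.commutativeSemigroup ℚP.+-0-commutativeMonoid)
    using (interchange)

  half-pos : ∀ {ε} → 0ℚ ℚ.< ε → 0ℚ ℚ.< ½ ℚ.* ε
  half-pos {ε} p = ℚP.positive⁻¹ (½ ℚ.* ε) {{ℚP.pos*pos⇒pos ½ ε {{ℚ.positive p}}}}

  halves : ∀ ε → ½ ℚ.* ε ℚ.+ ½ ℚ.* ε ≡ ε
  halves ε = trans (sym (ℚP.*-distribʳ-+ ε ½ ½)) (ℚP.*-identityˡ ε)

  <-halves : ∀ {ε} a b → ℚ.∣ a ∣ ℚ.< ½ ℚ.* ε → ℚ.∣ b ∣ ℚ.< ½ ℚ.* ε →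
             ℚ.∣ a ℚ.+ b ∣ ℚ.< ε
  <-halves {ε} a b a< b< = begin-strict
    ℚ.∣ a ℚ.+ b ∣            ≤⟨ ℚP.∣p+q∣≤∣p∣+∣q∣ a b ⟩
    ℚ.∣ a ∣ ℚ.+ ℚ.∣ b ∣      <⟨ ℚP.+-mono-< a< b< ⟩
    ½ ℚ.* ε ℚ.+ ½ ℚ.* ε      ≡⟨ halves ε ⟩
    ε                        ∎
    where open ℚP.≤-Reasoning

  sub-+ : ∀ a b c d → (a ℚ.+ b) ℚ.- (c ℚ.+ d) ≡ (a ℚ.- c) ℚ.+ (b ℚ.- d)
  sub-+ a b c d = trans (cong (a ℚ.+ b ℚ.+_) (ℚP.neg-distrib-+ c d))
                        (interchange a b (ℚ.- c) (ℚ.- d))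

  sub-neg : ∀ a b → (ℚ.- a) ℚ.- (ℚ.- b) ≡ ℚ.- (a ℚ.- b)
  sub-neg a b = sym (ℚP.neg-distrib-+ a (ℚ.- b))

  add-sub : ∀ a b → a ≡ (a ℚ.- b) ℚ.+ b
  add-sub a b = sym (trans (ℚP.+-assoc a (ℚ.- b) b)
    (trans (cong (a ℚ.+_) (ℚP.+-inverseˡ b)) (ℚP.+-identityʳ a)))

  telescope : ∀ a b c → a ℚ.- c ≡ (a ℚ.- b) ℚ.+ (b ℚ.- c)
  telescope a b c = trans (cong (ℚ._- c) (add-sub a b))
                          (ℚP.+-assoc (a ℚ.- b) b (ℚ.- c))

  *-distribˡ-sub : ∀ a b c → a ℚ.* (b ℚ.- c) ≡ a ℚ.* b ℚ.- a ℚ.* c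
  *-distribˡ-sub a b c = trans (ℚP.*-distribˡ-+ a b (ℚ.- c))
    (cong (a ℚ.* b ℚ.+_) (sym (ℚP.neg-distribʳ-* a c)))

  sub-* : ∀ a b c d →
          (a ℚ.* b) ℚ.- (c ℚ.* d) ≡ a ℚ.* (b ℚ.- d) ℚ.+ d ℚ.* (a ℚ.- c)
  sub-* a b c d = trans (telescope (a ℚ.* b) (a ℚ.* d) (c ℚ.* d))
    (cong₂ ℚ._+_ (sym (*-distribˡ-sub a b d))
      (trans (cong₂ ℚ._-_ (ℚP.*-comm a d) (ℚP.*-comm c d))
             (sym (*-distribˡ-sub d a c))))

  eventually-bounded : ∀ x → IsCauchy x →
    ∃[ B ] (0ℚ ℚ.< B × ∃[ N ] (∀ n → N ℕ.≤ n → ℚ.∣ x n ∣ ℚ.≤ B))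
  eventually-bounded x cx with cx 1ℚ (ℚP.positive⁻¹ 1ℚ)
  ... | N , close = 1ℚ ℚ.+ ℚ.∣ x N ∣
      , ℚP.+-mono-<-≤ (ℚP.positive⁻¹ 1ℚ) (ℚP.0≤∣p∣ (x N))
      , N
      , λ n N≤n → ℚP.≤-trans
          (ℚP.≤-reflexive (cong ℚ.∣_∣ (add-sub (x n) (x N))))
          (ℚP.≤-trans (ℚP.∣p+q∣≤∣p∣+∣q∣ (x n ℚ.- x N) (x N))
            (ℚP.+-monoˡ-≤ ℚ.∣ x N ∣ (ℚP.<⇒≤ (close n N N≤n ℕP.≤-refl))))

  shrink : ∀ B η → 0ℚ ℚ.< B → 0ℚ ℚ.< η →
    ∃[ δ ] (0ℚ ℚ.< δ ×
      (∀ a d → ℚ.∣ a ∣ ℚ.≤ B → ℚ.∣ d ∣ ℚ.< δ → ℚ.∣ a ℚ.* d ∣ ℚ.< η))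
  shrink B η B⁺ η⁺ = B⁻¹ ℚ.* η , δ⁺ , small
    where
    instance
      B-pos = ℚ.positive B⁺
      B-nz  = ℚP.pos⇒nonZero B

    B⁻¹ : ℚ
    B⁻¹ = ℚ.1/ B

    δ⁺ : 0ℚ ℚ.< B⁻¹ ℚ.* η
    δ⁺ = ℚP.positive⁻¹ (B⁻¹ ℚ.* η)
      {{ℚP.pos*pos⇒pos B⁻¹ {{ℚP.1/pos⇒pos B}} η {{ℚ.positive η⁺}}}}

    cancel : B ℚ.* (B⁻¹ ℚ.* η) ≡ η
    cancel = trans (sym (ℚP.*-assoc B B⁻¹ η))
      (trans (cong (ℚ._* η) (ℚP.*-inverseʳ B)) (ℚP.*-identityˡ η))

    small : ∀ a d → ℚ.∣ a ∣ ℚ.≤ B → ℚ.∣ d ∣ ℚ.< B⁻¹ ℚ.* η → ℚ.∣ a ℚ.* d ∣ ℚ.< η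
    small a d a≤ d< = begin-strict
      ℚ.∣ a ℚ.* d ∣          ≡⟨ ℚP.∣p*q∣≡∣p∣*∣q∣ a d ⟩
      ℚ.∣ a ∣ ℚ.* ℚ.∣ d ∣    ≤⟨ ℚP.*-monoʳ-≤-nonNeg ℚ.∣ d ∣ {{ℚP.∣-∣-nonNeg d}} a≤ ⟩
      B ℚ.* ℚ.∣ d ∣          <⟨ ℚP.*-monoʳ-<-pos B d< ⟩
      B ℚ.* (B⁻¹ ℚ.* η)      ≡⟨ cancel ⟩
      η                      ∎
      where open ℚP.≤-Reasoning

+-cauchy : ∀ x y → IsCauchy x → IsCauchy y → IsCauchy (λ n → x n ℚ.+ y n)
+-cauchy x y cx cy ε ε⁺ with cx (½ ℚ.* ε) (half-pos ε⁺) | cy (½ ℚ.* ε) (half-pos ε⁺)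
... | M , hx | N , hy = M ⊔ N , λ m n ≤m ≤n →
  subst (λ t → ℚ.∣ t ∣ ℚ.< ε) (sym (sub-+ (x m) (y m) (x n) (y n)))
    (<-halves (x m ℚ.- x n) (y m ℚ.- y n)
      (hx m n (ℕP.m⊔n≤o⇒m≤o M N ≤m) (ℕP.m⊔n≤o⇒m≤o M N ≤n))
      (hy m n (ℕP.m⊔n≤o⇒n≤o M N ≤m) (ℕP.m⊔n≤o⇒n≤o M N ≤n)))

neg-cauchy : ∀ x → IsCauchy x → IsCauchy (λ n → ℚ.- x n)
neg-cauchy x cx ε ε⁺ with cx ε ε⁺
... | N , h = N , λ m n ≤m ≤n →
  subst (ℚ._< ε)
    (sym (trans (cong ℚ.∣_∣ (sub-neg (x m) (x n))) (ℚP.∣-p∣≡∣p∣ (x m ℚ.- x n))))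
    (h m n ≤m ≤n)

*-cauchy : ∀ x y → IsCauchy x → IsCauchy y → IsCauchy (λ n → x n ℚ.* y n)
*-cauchy x y cx cy ε ε⁺
  with eventually-bounded x cx | eventually-bounded y cy
... | A , A⁺ , K , bx | B , B⁺ , L , by
  with shrink A (½ ℚ.* ε) A⁺ (half-pos ε⁺) | shrink B (½ ℚ.* ε) B⁺ (half-pos ε⁺)
... | α , α⁺ , smallA | β , β⁺ , smallB
  with cx β β⁺ | cy α α⁺
... | M , hx | N , hy = (K ⊔ L) ⊔ (M ⊔ N) , λ m n ≤m ≤n →
  subst (λ t → ℚ.∣ t ∣ ℚ.< ε) (sym (sub-* (x m) (y m) (x n) (y n)))
    (<-halves (x m ℚ.* (y m ℚ.- y n)) (y n ℚ.* (x m ℚ.- x n))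
      (smallA (x m) (y m ℚ.- y n) (bx m (ℕP.m⊔n≤o⇒m≤o K L (l ≤m)))
        (hy m n (ℕP.m⊔n≤o⇒n≤o M N (r ≤m)) (ℕP.m⊔n≤o⇒n≤o M N (r ≤n))))
      (smallB (y n) (x m ℚ.- x n) (by n (ℕP.m⊔n≤o⇒n≤o K L (l ≤n)))
        (hx m n (ℕP.m⊔n≤o⇒m≤o M N (r ≤m)) (ℕP.m⊔n≤o⇒m≤o M N (r ≤n)))))
  where
  l : ∀ {k} → (K ⊔ L) ⊔ (M ⊔ N) ℕ.≤ k → K ⊔ L ℕ.≤ k
  l = ℕP.m⊔n≤o⇒m≤o (K ⊔ L) (M ⊔ N)
  r : ∀ {k} → (K ⊔ L) ⊔ (M ⊔ N) ℕ.≤ k → M ⊔ N ℕ.≤ k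
  r = ℕP.m⊔n≤o⇒n≤o (K ⊔ L) (M ⊔ N)

infixl 6 _+ᵣ_ _-ᵣ_
infixl 7 _*ᵣ_

0ᵣ : ℝ
0ᵣ = mkℝ (λ _ → 0ℚ) (λ ε ε⁺ → 0 , λ _ _ _ _ → ε⁺)

_+ᵣ_ _-ᵣ_ _*ᵣ_ : ℝ → ℝ → ℝ
x +ᵣ y = mkℝ (λ n → seq x n ℚ.+ seq y n) (+-cauchy (seq x) (seq y) (cauchy x) (cauchy y))
x -ᵣ y = mkℝ (λ n → seq x n ℚ.- seq y n)
  (+-cauchy (seq x) (λ n → ℚ.- seq y n) (cauchy x) (neg-cauchy (seq y) (cauchy y)))
x *ᵣ y = mkℝ (λ n → seq x n ℚ.* seq y n) (*-cauchy (seq x) (seq y) (cauchy x) (cauchy y))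

record ℂ : Set where
  constructor _+i_
  field
    re im : ℝ

open ℂ public

infix 4 _≈_ _#_
infixl 6 _+_
infixl 7 _*_

_≈_ : ℂ → ℂ → Set
z ≈ w = re z ≈ᵣ re w × im z ≈ᵣ im w

_#_ : ℂ → ℂ → Set
z # w = re z #ᵣ re w ⊎ im z #ᵣ im w

0ℂ : ℂ
0ℂ = 0ᵣ +i 0ᵣ

_+_ _*_ : ℂ → ℂ → ℂ
z + w = (re z +ᵣ re w) +i (im z +ᵣ im w)
z * w = (re z *ᵣ re w -ᵣ im z *ᵣ im w) +i (re z *ᵣ im w +ᵣ im z *ᵣ re w)

-- The complex projective plane, in homogeneous coordinates.  All relations
-- below are invariant under rescaling.  Every negated notion of the
-- classical theory (nonzero, distinct, off a line, non-collinear) is given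
-- in its positive form in terms of _#_.

record ℙ² : Set where
  field
    coord   : Fin 3 → ℂ
    nonzero : ∃[ i ] coord i # 0ℂ

-- The line a₀ x₀ + a₁ x₁ + a₂ x₂ = 0.
record Line : Set where
  field
    coeff   : Fin 3 → ℂ
    nonzero : ∃[ i ] coeff i # 0ℂ

-- Distinct points: some 2 × 2 minor of the coordinates does not vanish.
_#ₚ_ : ℙ² → ℙ² → Set
X #ₚ Y = ∃[ i ] ∃[ j ] (x i * y j # x j * y i)
  where
  x = ℙ².coord X
  y = ℙ².coord Y

eval : Line → ℙ² → ℂ
eval L X = a 0F * x 0F + a 1F * x 1F + a 2F * x 2F
  where
  a = Line.coeff L
  x = ℙ².coord X

_on_ _off_ : ℙ² → Line → Set
X on  L = eval L X ≈ 0ℂ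
X off L = eval L X # 0ℂ

-- Y is the image of X under the projection from O onto L, i.e. the point
-- where the line joining O and X meets L; used for O off L.
record Projects (O : ℙ²) (L : Line) (X Y : ℙ²) : Set where
  field
    defined : X #ₚ O
    onto    : Y on L
    ray     : Line
    O-ray   : O on ray
    X-ray   : X on ray
    Y-ray   : Y on ray

PairwiseDistinct : ∀ {n} → (Fin n → ℙ²) → Set
PairwiseDistinct X = ∀ p q → p ≢ q → X p #ₚ X q

CollinearIn NonCollinearIn : ∀ {n} → (Fin n → ℙ²) → Subset n → Set
CollinearIn    X S = Σ[ L ∈ Line ] (∀ p → p ∈ S → X p on L)
NonCollinearIn X S = (L : Line) → ∃[ p ] (p ∈ S × X p off L)

-- The points are Fin n, whose usual order is the total order used to define
-- the graph.  By linearity and nontriviality, line is injective, so the lines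
-- form a set of subsets.
record Configuration (n : ℕ) : Set where
  field
    #lines   : ℕ
    line     : Fin #lines → Subset n
    linear   : ∀ {p q} → p ≢ q → ∀ k l →
               p ∈ line k → q ∈ line k → p ∈ line l → q ∈ line l → k ≡ l
    nontrivial : ∀ l → 2 ℕ.≤ ∣ line l ∣

module _ {n : ℕ} (C : Configuration n) where
  open Configuration C

  Consecutive : Fin n → Fin n → Set
  Consecutive p q = p Fin.< q × ∃[ l ] (p ∈ line l × q ∈ line l ×
    ¬ (∃[ k ] (k ∈ line l × p Fin.< k × k Fin.< q)))

  Adjacent : Fin n → Fin n → Set
  Adjacent p q = Consecutive p q ⊎ Consecutive q p

  Collinear : Subset n → Set
  Collinear S = ∃[ l ] (S ⊆ line l)

  -- Collinearity is compared on sets of at least three points, since any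
  -- two points of the plane are collinear.
  record IsNonDegenerateRealisation (X : Fin n → ℙ²) : Set where
    field
      distinct     : PairwiseDistinct X
      collinear    : ∀ S → 3 ℕ.≤ ∣ S ∣ → Collinear S → CollinearIn X S
      nonCollinear : ∀ S → 3 ℕ.≤ ∣ S ∣ → ¬ Collinear S → NonCollinearIn X S

  Liftable : Set
  Liftable = ∀ (Y : Fin n → ℙ²) (L : Line) →
    PairwiseDistinct Y → (∀ p → Y p on L) →
    Σ[ O ∈ ℙ² ] Σ[ X ∈ (Fin n → ℙ²) ]
      (O off L × IsNonDegenerateRealisation X × (∀ p → Projects O L (X p) (Y p)))

-- A cycle of length k + 3 in the graph with adjacency relation E.
record Cycle {n : ℕ} (E : Fin n → Fin n → Set) : Set where
  field
    k        : ℕ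
    vertex   : Fin (3 ℕ.+ k) → Fin n
    distinct : Injective _≡_ _≡_ vertex
    step     : ∀ i → E (vertex (inject₁ i)) (vertex (suc i))
    close    : E (vertex (fromℕ (2 ℕ.+ k))) (vertex zero)

IsForest : ∀ {n} → Configuration n → Set
IsForest C = ¬ Cycle (Adjacent C)

{-# OPTIONS --safe #-}
module Submission where

-- Project from a coordinate point O = e_i off L.  A lift of the points Y p then amounts
-- to a choice of heights h p for the i-th coordinate, and the lifts of p, q, r are
-- collinear exactly when h p [q r] + h q [r p] + h r [p q] = 0, where [p q] is the minor
-- of Y p and Y q in the other two coordinates, which does not vanish.
--
-- In a forest configuration every nonempty set of points has a point on at most one line
-- that meets the set again.  Applied to the points on two or more lines, this yields a
-- line ℓ with at most one point s on further lines (or else a point on no line), to be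
-- removed by induction.  Heights for the remaining points extend to ℓ by a linear form
-- whose value at s is prescribed; the remaining parameter of the form is chosen among the
-- natural numbers so as to avoid finitely many values, at most one for each triple that
-- has to be non-collinear.

open import Defs hiding (_≈_; _#_; _+_; _*_; eval)
import Defs as ℂ

open import Algebra.Bundles using (CommutativeRing)
import Algebra.Consequences.Setoid as SetoidConsequences
import Algebra.Properties.AbelianGroup as AbelianGroupProperties
open import Algebra.Properties.Ring using (-‿distribˡ-*; -‿distribʳ-*; -1*x≈-x)
import Algebra.Properties.Semiring.Mult as SemiringMult
import Algebra.Solver.Ring as RingSolver
open import Algebra.Solver.Ring.AlmostCommutativeRing
  using (_-Raw-AlmostCommutative⟶_; fromCommutativeRing)
open import Data.Bool.Base using (if_then_else_)
open import Data.Fin.Base as Fin using (Fin; zero; suc; toℕ; inject₁; fromℕ; combine; remQuot)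
import Data.Fin.Induction as FinI
open import Data.Fin.Patterns using (0F; 1F; 2F)
import Data.Fin.Properties as FinP
open import Data.Fin.Subset
  using (Subset; inside; outside; _∈_; _∉_; _⊆_; _⊂_; _─_; ⁅_⁆; _∪_; ∣_∣; ⊤; ⊥; Nonempty)
  renaming (_-_ to _∖_)
open import Data.Fin.Subset.Induction using (⊂-wellFounded)
open import Data.Fin.Subset.Properties
open import Data.Integer.Base as ℤ using (ℤ; +_; -[1+_])
import Data.Integer.Properties as ℤP
open import Data.Maybe.Base as Maybe using (Maybe)
open import Data.Nat.Base as ℕ using (ℕ; zero; suc; z≤n; s≤s; _⊔_)
import Data.Nat.Induction as ℕI
import Data.Nat.Properties as ℕP
open import Data.Product.Base as Product using (_×_; _,_; ∃-syntax; Σ-syntax; proj₁; proj₂)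
open import Data.Rational.Base as ℚ using (ℚ; 0ℚ; 1ℚ; ½)
import Data.Rational.Properties as ℚP
import Data.Sign.Base as Sign
open import Data.Sum.Base as Sum using (_⊎_; inj₁; inj₂; [_,_]′)
open import Data.Vec.Base using ([]; _∷_; here; there)
open import Function.Base using (_∘_; id)
open import Function.Definitions using (Injective)
open import Induction.WellFounded using (Acc; acc)
open import Level using (0ℓ)
open import Relation.Binary.Bundles using (Setoid)
open import Relation.Binary.Definitions using (Decidable; tri<; tri≈; tri>)
open import Relation.Binary.PropositionalEquality as ≡ using (_≡_; _≢_)
import Relation.Binary.Reasoning.Setoid as SetoidReasoning
open import Relation.Binary.Structures using (IsEquivalence)
open import Relation.Nullary using (¬_; Dec; yes; no; does; contradiction)
open import Relation.Nullary.Decidable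
  using (_×-dec_; _⊎-dec_; _→-dec_; ¬?; decidable-stable; dec-true; dec-false; dec⇒maybe)
open import Relation.Unary as Unary using ()

-- The setting is constructive: equality and apartness of complex numbers are not decidable, so no
-- step may ask whether a number vanishes. Genericity is carried by disjunctions (of two parameter
-- values at least one is good), and division is replaced by multiplying with factors known to be
-- nonzero and cancelling through `nonZero-*⁻ʳ`. Case distinctions are confined to finite sets and
-- rational numbers.
--
-- The leaf structure is what leaves room for choosing heights. Heights given by a linear form in
-- the other two coordinates put a whole line of points on a common line, and such a form has two
-- degrees of freedom: the single point s shared with the rest uses one, and the other remains to
-- break unwanted collinearities. A second shared point would leave none.
--
-- The index i is one at which L has a nonzero coefficient. Then e_i is off L, and the other two
-- coordinates are homogeneous coordinates on L, which is why minors of distinct points do not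
-- vanish.

-- Polynomial identities in commutative rings

module IntegerRingSolver (R : CommutativeRing 0ℓ 0ℓ) where

  open CommutativeRing R
  open AbelianGroupProperties +-abelianGroup
    using (⁻¹-involutive; ⁻¹-∙-comm; ε⁻¹≈ε)
  open SemiringMult semiring using (×-homo-+; ×1-homo-*) renaming (_×_ to _·_)
  open SetoidReasoning setoid

  -- Coefficients are integers, because the solver must recognise equal coefficients and equality in
  -- `Carrier` is not decidable for the reals.
  fromℤ : ℤ → Carrier
  fromℤ (+ n)    = n · 1#
  fromℤ -[1+ n ] = - (suc n · 1#)

  private
    fromℤ-neg : ∀ i → fromℤ (ℤ.- i) ≈ - fromℤ i
    fromℤ-neg (+ zero)  = sym ε⁻¹≈ε
    fromℤ-neg (+ suc n) = refl
    fromℤ-neg -[1+ n ]  = sym (⁻¹-involutive _)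

    fromℤ-⊖ : ∀ m n → fromℤ (m ℤ.⊖ n) ≈ m · 1# - n · 1#
    fromℤ-⊖ m       zero    = begin
      m · 1#       ≈⟨ +-identityʳ _ ⟨
      m · 1# + 0#  ≈⟨ +-congˡ ε⁻¹≈ε ⟨
      m · 1# - 0#  ∎
    fromℤ-⊖ zero    (suc n) = sym (+-identityˡ _)
    fromℤ-⊖ (suc m) (suc n) = begin
      fromℤ (suc m ℤ.⊖ suc n)
        ≡⟨ ≡.cong fromℤ (ℤP.[1+m]⊖[1+n]≡m⊖n m n) ⟩
      fromℤ (m ℤ.⊖ n)
        ≈⟨ fromℤ-⊖ m n ⟩
      a - b
        ≈⟨ +-congʳ (+-identityˡ a) ⟨
      0# + a - b
        ≈⟨ +-congʳ (+-congʳ (-‿inverseʳ 1#)) ⟨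
      1# - 1# + a - b
        ≈⟨ +-congʳ (trans (+-assoc _ _ _) (+-congˡ (+-comm _ _))) ⟩
      1# + (a - 1#) - b
        ≈⟨ +-congʳ (+-assoc _ _ _) ⟨
      1# + a - 1# - b
        ≈⟨ +-assoc _ _ _ ⟩
      1# + a + (- 1# - b)
        ≈⟨ +-congˡ (⁻¹-∙-comm 1# b) ⟩
      1# + a - (1# + b) ∎
      where
      a = m · 1#
      b = n · 1#

    fromℤ-+ : ∀ i j → fromℤ (i ℤ.+ j) ≈ fromℤ i + fromℤ j
    fromℤ-+ (+ m)    (+ n)    = ×-homo-+ 1# m n
    fromℤ-+ (+ m)    -[1+ n ] = fromℤ-⊖ m (suc n)
    fromℤ-+ -[1+ m ] (+ n)    = trans (fromℤ-⊖ n (suc m)) (+-comm _ _)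
    fromℤ-+ -[1+ m ] -[1+ n ] = begin
      - (suc (suc (m ℕ.+ n)) · 1#)
        ≈⟨ -‿cong (+-congˡ (×-homo-+ 1# (suc m) n)) ⟩
      - (1# + (suc m · 1# + n · 1#))
        ≈⟨ -‿cong (trans (sym (+-assoc _ _ _)) (trans (+-congʳ (+-comm _ _)) (+-assoc _ _ _))) ⟩
      - (suc m · 1# + suc n · 1#)
        ≈⟨ ⁻¹-∙-comm _ _ ⟨
      - (suc m · 1#) - suc n · 1# ∎

    fromℤ-+◃ : ∀ n → fromℤ (Sign.+ ℤ.◃ n) ≈ n · 1#
    fromℤ-+◃ n = reflexive (≡.cong fromℤ (ℤP.+◃n≡+n n))

    fromℤ--◃ : ∀ n → fromℤ (Sign.- ℤ.◃ n) ≈ - (n · 1#)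
    fromℤ--◃ n = trans (reflexive (≡.cong fromℤ (ℤP.-◃n≡-n n))) (fromℤ-neg (+ n))

    fromℤ-* : ∀ i j → fromℤ (i ℤ.* j) ≈ fromℤ i * fromℤ j
    fromℤ-* (+ m)    (+ n)    = trans (fromℤ-+◃ (m ℕ.* n)) (×1-homo-* m n)
    fromℤ-* (+ m)    -[1+ n ] = trans (fromℤ--◃ (m ℕ.* suc n))
      (trans (-‿cong (×1-homo-* m (suc n))) (-‿distribʳ-* ring _ _))
    fromℤ-* -[1+ m ] (+ n)    = trans (fromℤ--◃ (suc m ℕ.* n))
      (trans (-‿cong (×1-homo-* (suc m) n)) (-‿distribˡ-* ring _ _))
    fromℤ-* -[1+ m ] -[1+ n ] = trans (fromℤ-+◃ (suc m ℕ.* suc n)) (trans (×1-homo-* (suc m) (suc n)) (begin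
      a * b      ≈⟨ ⁻¹-involutive _ ⟨
      - - (a * b)  ≈⟨ -‿cong (-‿distribʳ-* ring a b) ⟩
      - (a * - b)  ≈⟨ -‿distribˡ-* ring a (- b) ⟩
      - a * - b    ∎))
      where
      a = suc m · 1#
      b = suc n · 1#

    morphism : ℤ.+-*-rawRing -Raw-AlmostCommutative⟶ fromCommutativeRing R
    morphism = record
      { ⟦_⟧    = fromℤ
      ; +-homo = fromℤ-+
      ; *-homo = fromℤ-*
      ; -‿homo = fromℤ-neg
      ; 0-homo = refl
      ; 1-homo = +-identityʳ 1#
      }

    _coeff≟_ : ∀ i j → Maybe (fromℤ i ≈ fromℤ j)
    i coeff≟ j = Maybe.map (λ eq → reflexive (≡.cong fromℤ eq)) (dec⇒maybe (i ℤP.≟ j))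

  open RingSolver ℤ.+-*-rawRing (fromCommutativeRing R) morphism _coeff≟_ public
    using (Polynomial; solve; con; _:+_; _:*_; _:-_; :-_; _:=_)

module Differences (R : CommutativeRing 0ℓ 0ℓ) where

  open CommutativeRing R
  open IntegerRingSolver R

  cancel : ∀ a b → a ≈ a - b + b
  cancel = solve 2 (λ a b → a := a :- b :+ b) refl

  swap : ∀ a b → - (a - b) ≈ b - a
  swap = solve 2 (λ a b → :- (a :- b) := b :- a) refl

  chain : ∀ a b c → (a - b) + (b - c) ≈ a - c
  chain = solve 3 (λ a b c → (a :- b) :+ (b :- c) := a :- c) refl

  sum : ∀ a a′ b b′ → (a - a′) + (b - b′) ≈ (a + b) - (a′ + b′)
  sum = solve 4 (λ a a′ b b′ → (a :- a′) :+ (b :- b′) := (a :+ b) :- (a′ :+ b′)) refl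

  negation : ∀ a a′ → - (a - a′) ≈ - a - - a′
  negation = solve 2 (λ a a′ → :- (a :- a′) := :- a :- (:- a′)) refl

  product : ∀ a a′ b b′ → a * (b - b′) + b′ * (a - a′) ≈ a * b - a′ * b′
  product = solve 4 (λ a a′ b b′ → a :* (b :- b′) :+ b′ :* (a :- a′) := a :* b :- a′ :* b′) refl


-- The identities behind complex multiplication, with a + i a′ for the pair a, a′.
module Complexification (R : CommutativeRing 0ℓ 0ℓ) where

  open CommutativeRing R
  open IntegerRingSolver R

  re-assoc : ∀ a a′ b b′ c c′ →
    (a * b - a′ * b′) * c - (a * b′ + a′ * b) * c′ ≈
    a * (b * c - b′ * c′) - a′ * (b * c′ + b′ * c)
  re-assoc = solve 6 (λ a a′ b b′ c c′ →
    (a :* b :- a′ :* b′) :* c :- (a :* b′ :+ a′ :* b) :* c′ :=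
    a :* (b :* c :- b′ :* c′) :- a′ :* (b :* c′ :+ b′ :* c)) refl

  im-assoc : ∀ a a′ b b′ c c′ →
    (a * b - a′ * b′) * c′ + (a * b′ + a′ * b) * c ≈
    a * (b * c′ + b′ * c) + a′ * (b * c - b′ * c′)
  im-assoc = solve 6 (λ a a′ b b′ c c′ →
    (a :* b :- a′ :* b′) :* c′ :+ (a :* b′ :+ a′ :* b) :* c :=
    a :* (b :* c′ :+ b′ :* c) :+ a′ :* (b :* c :- b′ :* c′)) refl

  re-comm : ∀ a a′ b b′ → a * b - a′ * b′ ≈ b * a - b′ * a′
  re-comm = solve 4 (λ a a′ b b′ → a :* b :- a′ :* b′ := b :* a :- b′ :* a′) refl

  im-comm : ∀ a a′ b b′ → a * b′ + a′ * b ≈ b * a′ + b′ * a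
  im-comm = solve 4 (λ a a′ b b′ → a :* b′ :+ a′ :* b := b :* a′ :+ b′ :* a) refl

  re-identityˡ : ∀ a a′ → 1# * a - 0# * a′ ≈ a
  re-identityˡ a a′ = trans
    (solve 3 (λ e a a′ → e :* a :- con (+ 0) :* a′ := e :* a) refl 1# a a′) (*-identityˡ a)

  im-identityˡ : ∀ a a′ → 1# * a′ + 0# * a ≈ a′
  im-identityˡ a a′ = trans
    (solve 3 (λ e a a′ → e :* a′ :+ con (+ 0) :* a := e :* a′) refl 1# a a′) (*-identityˡ a′)

  re-distribˡ : ∀ a a′ b b′ c c′ →
    a * (b + c) - a′ * (b′ + c′) ≈ (a * b - a′ * b′) + (a * c - a′ * c′)
  re-distribˡ = solve 6 (λ a a′ b b′ c c′ → a :* (b :+ c) :- a′ :* (b′ :+ c′) :=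
    (a :* b :- a′ :* b′) :+ (a :* c :- a′ :* c′)) refl

  im-distribˡ : ∀ a a′ b b′ c c′ →
    a * (b′ + c′) + a′ * (b + c) ≈ (a * b′ + a′ * b) + (a * c′ + a′ * c)
  im-distribˡ = solve 6 (λ a a′ b b′ c c′ → a :* (b′ :+ c′) :+ a′ :* (b :+ c) :=
    (a :* b′ :+ a′ :* b) :+ (a :* c′ :+ a′ :* c)) refl

  norm-* : ∀ a a′ b b′ →
    (a * a + a′ * a′) * (b * b + b′ * b′) ≈
    (a * b - a′ * b′) * (a * b - a′ * b′) + (a * b′ + a′ * b) * (a * b′ + a′ * b)
  norm-* = solve 4 (λ a a′ b b′ →
    (a :* a :+ a′ :* a′) :* (b :* b :+ b′ :* b′) :=
    (a :* b :- a′ :* b′) :* (a :* b :- a′ :* b′) :+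
    (a :* b′ :+ a′ :* b) :* (a :* b′ :+ a′ :* b)) refl

-- All that the geometry uses about ℂ. `nonZero-*⁻ʳ` does the work of inverses, `nonZero-+` replaces
-- case distinctions on vanishing, and `nonZero-suc·` (characteristic zero) makes the natural
-- numbers an infinite supply of parameters.
record ApartnessRing : Set₁ where
  field
    commutativeRing : CommutativeRing 0ℓ 0ℓ
  open CommutativeRing commutativeRing public
  open SemiringMult semiring public using () renaming (_×_ to _·_)
  field
    NonZero      : Carrier → Set
    nonZero-resp : ∀ {x y} → x ≈ y → NonZero x → NonZero y
    nonZero-*    : ∀ {x y} → NonZero x → NonZero y → NonZero (x * y)
    nonZero-*⁻ʳ  : ∀ {x y} → NonZero (x * y) → NonZero y
    nonZero-+    : ∀ {x y} → NonZero (x + y) → NonZero x ⊎ NonZero y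
    nonZero-suc· : ∀ n → NonZero (suc n · 1#)

-- Estimates for sequences of rational numbers

private
  module ℚ-differences = Differences ℚP.+-*-commutativeRing

Eventually : (ℕ → Set) → Set
Eventually P = ∃[ N ] (∀ n → N ℕ.≤ n → P n)

eventually-zip : {P Q R : ℕ → Set} → (∀ {n} → P n → Q n → R n) →
                 Eventually P → Eventually Q → Eventually R
eventually-zip f (M , p) (N , q) = M ⊔ N , λ n ≤n →
  f (p n (ℕP.m⊔n≤o⇒m≤o M N ≤n)) (q n (ℕP.m⊔n≤o⇒n≤o M N ≤n))

eventually-map : {P Q : ℕ → Set} → (∀ {n} → P n → Q n) → Eventually P → Eventually Q
eventually-map f (N , p) = N , λ n N≤n → f (p n N≤n)

½*-pos : ∀ {ε} → 0ℚ ℚ.< ε → 0ℚ ℚ.< ½ ℚ.* ε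
½*-pos ε⁺ = ℚP.*-monoʳ-<-pos ½ ε⁺

∣+∣<-halves : ∀ {ε a b} → ℚ.∣ a ∣ ℚ.< ½ ℚ.* ε → ℚ.∣ b ∣ ℚ.< ½ ℚ.* ε → ℚ.∣ a ℚ.+ b ∣ ℚ.< ε
∣+∣<-halves {ε} {a} {b} a< b< = begin-strict
  ℚ.∣ a ℚ.+ b ∣         ≤⟨ ℚP.∣p+q∣≤∣p∣+∣q∣ a b ⟩
  ℚ.∣ a ∣ ℚ.+ ℚ.∣ b ∣   <⟨ ℚP.+-mono-< a< b< ⟩
  ½ ℚ.* ε ℚ.+ ½ ℚ.* ε   ≡⟨ ℚP.*-distribʳ-+ ε ½ ½ ⟨
  1ℚ ℚ.* ε              ≡⟨ ℚP.*-identityˡ ε ⟩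
  ε                     ∎
  where open ℚP.≤-Reasoning

large-summand : ∀ {ε} a b → ε ℚ.≤ ℚ.∣ a ℚ.+ b ∣ → ℚ.∣ a ∣ ℚ.< ½ ℚ.* ε → ½ ℚ.* ε ℚ.≤ ℚ.∣ b ∣
large-summand a b ε≤ a< = ℚP.≮⇒≥ λ b< →
  ℚP.<-irrefl ≡.refl (ℚP.≤-<-trans ε≤ (∣+∣<-halves {a = a} {b} a< b<))

half-of-sum : ∀ {ε} a b → ε ℚ.≤ ℚ.∣ a ℚ.+ b ∣ →
              ½ ℚ.* ε ℚ.≤ ℚ.∣ a ∣ ⊎ ½ ℚ.* ε ℚ.≤ ℚ.∣ b ∣
half-of-sum {ε} a b ε≤ with ½ ℚ.* ε ℚP.≤? ℚ.∣ a ∣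
... | yes a≥ = inj₁ a≥
... | no  a≱ = inj₂ (large-summand a b ε≤ (ℚP.≰⇒> a≱))

factor-bound : ∀ {B η} → 0ℚ ℚ.< B → 0ℚ ℚ.< η → ∃[ δ ] (0ℚ ℚ.< δ ×
  (∀ {a d} → ℚ.∣ a ∣ ℚ.≤ B → ℚ.∣ d ∣ ℚ.< δ → ℚ.∣ a ℚ.* d ∣ ℚ.< η))
factor-bound {B} {η} B⁺ η⁺ = η ℚ.÷ B , δ⁺ , small
  where
  instance
    B-pos = ℚ.positive B⁺
    B-nz  = ℚP.pos⇒nonZero B
    η-pos = ℚ.positive η⁺
  δ⁺ : 0ℚ ℚ.< η ℚ.÷ B
  δ⁺ = ℚP.positive⁻¹ _ {{ℚP.pos*pos⇒pos η (ℚ.1/ B) {{ℚP.1/pos⇒pos B}}}}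
  small : ∀ {a d} → ℚ.∣ a ∣ ℚ.≤ B → ℚ.∣ d ∣ ℚ.< η ℚ.÷ B → ℚ.∣ a ℚ.* d ∣ ℚ.< η
  small {a} {d} a≤ d< = begin-strict
    ℚ.∣ a ℚ.* d ∣          ≡⟨ ℚP.∣p*q∣≡∣p∣*∣q∣ a d ⟩
    ℚ.∣ a ∣ ℚ.* ℚ.∣ d ∣    ≤⟨ ℚP.*-monoʳ-≤-nonNeg ℚ.∣ d ∣ {{ℚP.∣-∣-nonNeg d}} a≤ ⟩
    B ℚ.* ℚ.∣ d ∣          <⟨ ℚP.*-monoʳ-<-pos B d< ⟩
    B ℚ.* (η ℚ.* ℚ.1/ B)   ≡⟨ ℚP.*-comm B _ ⟩
    η ℚ.* ℚ.1/ B ℚ.* B     ≡⟨ ℚP.*-assoc η _ B ⟩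
    η ℚ.* (ℚ.1/ B ℚ.* B)   ≡⟨ ≡.cong (η ℚ.*_) (ℚP.*-inverseˡ B) ⟩
    η ℚ.* 1ℚ               ≡⟨ ℚP.*-identityʳ η ⟩
    η                      ∎
    where open ℚP.≤-Reasoning

-- Real numbers

infix 8 -ᵣ_

-ᵣ_ : ℝ → ℝ
-ᵣ x = mkℝ (λ n → ℚ.- seq x n) (neg-cauchy (seq x) (cauchy x))

constᵣ : ℚ → ℝ
constᵣ q = mkℝ (λ _ → q) λ ε ε⁺ → 0 , λ _ _ _ _ →
  ≡.subst (ℚ._< ε) (≡.cong ℚ.∣_∣ (≡.sym (ℚP.+-inverseʳ q))) ε⁺

bounded : ∀ x → ∃[ B ] (0ℚ ℚ.< B × Eventually λ n → ℚ.∣ seq x n ∣ ℚ.≤ B)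
bounded x with cauchy x 1ℚ (ℚP.positive⁻¹ 1ℚ)
... | N , close = 1ℚ ℚ.+ ℚ.∣ c ∣
    , ℚP.+-mono-<-≤ (ℚP.positive⁻¹ 1ℚ) (ℚP.0≤∣p∣ c) , N , bound
  where
  open ℚP.≤-Reasoning
  c = seq x N
  bound : ∀ n → N ℕ.≤ n → ℚ.∣ seq x n ∣ ℚ.≤ 1ℚ ℚ.+ ℚ.∣ c ∣
  bound n N≤n = begin
    ℚ.∣ seq x n ∣                        ≡⟨ ≡.cong ℚ.∣_∣ (ℚ-differences.cancel (seq x n) c) ⟩
    ℚ.∣ seq x n ℚ.- c ℚ.+ c ∣            ≤⟨ ℚP.∣p+q∣≤∣p∣+∣q∣ (seq x n ℚ.- c) c ⟩
    ℚ.∣ seq x n ℚ.- c ∣ ℚ.+ ℚ.∣ c ∣      ≤⟨ ℚP.+-monoˡ-≤ ℚ.∣ c ∣ (ℚP.<⇒≤ (close n N N≤n ℕP.≤-refl)) ⟩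
    1ℚ ℚ.+ ℚ.∣ c ∣                       ∎

-- `x ≈ᵣ y` unfolds to `Null` of the termwise difference, so the congruence laws below follow from
-- closure properties of null sequences together with the identities of `Differences`.
Null : (ℕ → ℚ) → Set
Null a = ∀ ε → 0ℚ ℚ.< ε → Eventually λ n → ℚ.∣ a n ∣ ℚ.< ε

null-resp : ∀ {a b} → (∀ n → a n ≡ b n) → Null a → Null b
null-resp a≡b a→0 ε ε⁺ = eventually-map (λ {n} → ≡.subst (λ t → ℚ.∣ t ∣ ℚ.< ε) (a≡b n)) (a→0 ε ε⁺)

null-+ : ∀ {a b} → Null a → Null b → Null (λ n → a n ℚ.+ b n)
null-+ {a} {b} a→0 b→0 ε ε⁺ = eventually-zip (λ {n} → ∣+∣<-halves {a = a n} {b n})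
  (a→0 (½ ℚ.* ε) (½*-pos ε⁺)) (b→0 (½ ℚ.* ε) (½*-pos ε⁺))

null-neg : ∀ {a} → Null a → Null (λ n → ℚ.- a n)
null-neg {a} a→0 ε ε⁺ = eventually-map (λ {n} → ≡.subst (ℚ._< ε) (≡.sym (ℚP.∣-p∣≡∣p∣ (a n)))) (a→0 ε ε⁺)

null-* : ∀ x {a} → Null a → Null (λ n → seq x n ℚ.* a n)
null-* x {a} a→0 ε ε⁺ =
  let B , B⁺ , x≤B = bounded x
      δ , δ⁺ , small = factor-bound B⁺ ε⁺
  in eventually-zip (λ {n} → small {seq x n} {a n}) x≤B (a→0 δ δ⁺)

pointwise : ∀ {x y} → (∀ n → seq x n ≡ seq y n) → x ≈ᵣ y
pointwise {x} {y} x≡y ε ε⁺ = 0 , λ n _ → ≡.subst (ℚ._< ε)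
  (≡.cong ℚ.∣_∣ (≡.sym (≡.trans (≡.cong (ℚ._- seq y n) (x≡y n)) (ℚP.+-inverseʳ (seq y n))))) ε⁺

≈ᵣ-sym : ∀ {x y} → x ≈ᵣ y → y ≈ᵣ x
≈ᵣ-sym {x} {y} x≈y = null-resp (λ n → ℚ-differences.swap (seq x n) (seq y n))
  (null-neg x≈y)

≈ᵣ-trans : ∀ {x y z} → x ≈ᵣ y → y ≈ᵣ z → x ≈ᵣ z
≈ᵣ-trans {x} {y} {z} x≈y y≈z = null-resp
  (λ n → ℚ-differences.chain (seq x n) (seq y n) (seq z n))
  (null-+ x≈y y≈z)

+ᵣ-cong : ∀ {x x′ y y′} → x ≈ᵣ x′ → y ≈ᵣ y′ → x +ᵣ y ≈ᵣ x′ +ᵣ y′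
+ᵣ-cong {x} {x′} {y} {y′} x≈ y≈ = null-resp
  (λ n → ℚ-differences.sum (seq x n) (seq x′ n) (seq y n) (seq y′ n))
  (null-+ x≈ y≈)

-ᵣ-cong : ∀ {x x′} → x ≈ᵣ x′ → -ᵣ x ≈ᵣ -ᵣ x′
-ᵣ-cong {x} {x′} x≈ = null-resp
  (λ n → ℚ-differences.negation (seq x n) (seq x′ n))
  (null-neg x≈)

*ᵣ-cong : ∀ {x x′ y y′} → x ≈ᵣ x′ → y ≈ᵣ y′ → x *ᵣ y ≈ᵣ x′ *ᵣ y′
*ᵣ-cong {x} {x′} {y} {y′} x≈ y≈ = null-resp
  (λ n → ℚ-differences.product (seq x n) (seq x′ n) (seq y n) (seq y′ n))
  (null-+ (null-* x y≈) (null-* y′ x≈))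

ℝ-commutativeRing : CommutativeRing 0ℓ 0ℓ
ℝ-commutativeRing = record
  { Carrier = ℝ
  ; _≈_ = _≈ᵣ_
  ; _+_ = _+ᵣ_
  ; _*_ = _*ᵣ_
  ; -_  = -ᵣ_
  ; 0#  = 0ᵣ
  ; 1#  = constᵣ 1ℚ
  ; isCommutativeRing = record
    { isRing = record
      { +-isAbelianGroup = record
        { isGroup = record
          { isMonoid = record
            { isSemigroup = record
              { isMagma = record
                { isEquivalence = record
                  { refl  = λ {x} → pointwise {x} {x} λ _ → ≡.refl
                  ; sym   = λ {x} {y} → ≈ᵣ-sym {x} {y}
                  ; trans = λ {x} {y} {z} → ≈ᵣ-trans {x} {y} {z}
                  }
                ; ∙-cong = λ {x} {x′} {y} {y′} → +ᵣ-cong {x} {x′} {y} {y′}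
                }
              ; assoc = λ x y z → pointwise {x +ᵣ y +ᵣ z} {x +ᵣ (y +ᵣ z)}
                  λ n → ℚP.+-assoc (seq x n) (seq y n) (seq z n)
              }
            ; identity = (λ x → pointwise {0ᵣ +ᵣ x} {x} λ n → ℚP.+-identityˡ (seq x n))
                       , (λ x → pointwise {x +ᵣ 0ᵣ} {x} λ n → ℚP.+-identityʳ (seq x n))
            }
          ; inverse = (λ x → pointwise { -ᵣ x +ᵣ x} {0ᵣ} λ n → ℚP.+-inverseˡ (seq x n))
                    , (λ x → pointwise {x +ᵣ -ᵣ x} {0ᵣ} λ n → ℚP.+-inverseʳ (seq x n))
          ; ⁻¹-cong = λ {x} {x′} → -ᵣ-cong {x} {x′}
          }
        ; comm = λ x y → pointwise {x +ᵣ y} {y +ᵣ x} λ n → ℚP.+-comm (seq x n) (seq y n)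
        }
      ; *-cong = λ {x} {x′} {y} {y′} → *ᵣ-cong {x} {x′} {y} {y′}
      ; *-assoc = λ x y z → pointwise {x *ᵣ y *ᵣ z} {x *ᵣ (y *ᵣ z)}
          λ n → ℚP.*-assoc (seq x n) (seq y n) (seq z n)
      ; *-identity = (λ x → pointwise {constᵣ 1ℚ *ᵣ x} {x} λ n → ℚP.*-identityˡ (seq x n))
                   , (λ x → pointwise {x *ᵣ constᵣ 1ℚ} {x} λ n → ℚP.*-identityʳ (seq x n))
      ; distrib = (λ x y z → pointwise {x *ᵣ (y +ᵣ z)} {x *ᵣ y +ᵣ x *ᵣ z}
                     λ n → ℚP.*-distribˡ-+ (seq x n) (seq y n) (seq z n))
                , (λ x y z → pointwise {(y +ᵣ z) *ᵣ x} {y *ᵣ x +ᵣ z *ᵣ x}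
                     λ n → ℚP.*-distribʳ-+ (seq x n) (seq y n) (seq z n))
      }
    ; *-comm = λ x y → pointwise {x *ᵣ y} {y *ᵣ x} λ n → ℚP.*-comm (seq x n) (seq y n)
    }
  }

-- Since x -ᵣ y is computed termwise, x #ᵣ y is by definition NonZeroᵣ (x -ᵣ y).
NonZeroᵣ : ℝ → Set
NonZeroᵣ x = ∃[ ε ] (0ℚ ℚ.< ε × Eventually λ n → ε ℚ.≤ ℚ.∣ seq x n ∣)

nonZeroᵣ-resp : ∀ {x y} → x ≈ᵣ y → NonZeroᵣ x → NonZeroᵣ y
nonZeroᵣ-resp {x} {y} x≈y (ε , ε⁺ , ε≤x) = ½ ℚ.* ε , ½*-pos ε⁺ ,
  eventually-zip (λ {n} ε≤ close → large-summand (seq x n ℚ.- seq y n) (seq y n)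
      (≡.subst (λ t → ε ℚ.≤ ℚ.∣ t ∣)
        (ℚ-differences.cancel (seq x n) (seq y n)) ε≤) close)
    ε≤x (x≈y (½ ℚ.* ε) (½*-pos ε⁺))

nonZeroᵣ-* : ∀ {x y} → NonZeroᵣ x → NonZeroᵣ y → NonZeroᵣ (x *ᵣ y)
nonZeroᵣ-* {x} {y} (ε , ε⁺ , ε≤) (δ , δ⁺ , δ≤) = ε ℚ.* δ
  , ℚP.positive⁻¹ _ {{ℚP.pos*pos⇒pos ε {{ℚ.positive ε⁺}} δ {{ℚ.positive δ⁺}}}}
  , eventually-zip (λ {n} ε≤x δ≤y → begin
      ε ℚ.* δ                          ≤⟨ ℚP.*-monoˡ-≤-nonNeg ε {{ℚ.nonNegative (ℚP.<⇒≤ ε⁺)}} δ≤y ⟩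
      ε ℚ.* ℚ.∣ seq y n ∣              ≤⟨ ℚP.*-monoʳ-≤-nonNeg ℚ.∣ seq y n ∣ {{ℚP.∣-∣-nonNeg (seq y n)}} ε≤x ⟩
      ℚ.∣ seq x n ∣ ℚ.* ℚ.∣ seq y n ∣  ≡⟨ ℚP.∣p*q∣≡∣p∣*∣q∣ (seq x n) (seq y n) ⟨
      ℚ.∣ seq x n ℚ.* seq y n ∣        ∎) ε≤ δ≤
  where open ℚP.≤-Reasoning

-- The factor `x` is eventually bounded, so a small term of `y` would force the product below its
-- bound ε.
nonZeroᵣ-*⁻ʳ : ∀ {x y} → NonZeroᵣ (x *ᵣ y) → NonZeroᵣ y
nonZeroᵣ-*⁻ʳ {x} {y} (ε , ε⁺ , ε≤) =
  let B , B⁺ , x≤B = bounded x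
      δ , δ⁺ , small = factor-bound B⁺ ε⁺
  in δ , δ⁺ , eventually-zip
       (λ {n} ε≤xy x≤ → ℚP.≮⇒≥ λ y<δ →
         ℚP.<-irrefl ≡.refl (ℚP.≤-<-trans ε≤xy (small {seq x n} {seq y n} x≤ y<δ)))
       ε≤ x≤B

-- Past the Cauchy modulus for ε/2 a single large term suffices, since all later terms stay within
-- ε/2 of it. The index `N` depends on ε alone, so one `m` can be chosen for two sequences at once.
nonZeroᵣ-at : ∀ x {ε} → 0ℚ ℚ.< ε → ∃[ N ] (∀ m → N ℕ.≤ m → ε ℚ.≤ ℚ.∣ seq x m ∣ → NonZeroᵣ x)
nonZeroᵣ-at x {ε} ε⁺ =
  let N , close = cauchy x (½ ℚ.* ε) (½*-pos ε⁺)
  in N , λ m N≤m ε≤ → ½ ℚ.* ε , ½*-pos ε⁺ , N , λ n N≤n →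
       large-summand (seq x m ℚ.- seq x n) (seq x n)
         (≡.subst (λ t → ε ℚ.≤ ℚ.∣ t ∣) (ℚ-differences.cancel (seq x m) (seq x n)) ε≤)
         (close m n N≤m N≤n)

-- The disjunction is decided by a rational comparison at one index that is late enough for `x`, `y`
-- and their sum.
nonZeroᵣ-+ : ∀ {x y} → NonZeroᵣ (x +ᵣ y) → NonZeroᵣ x ⊎ NonZeroᵣ y
nonZeroᵣ-+ {x} {y} (ε , ε⁺ , K , ε≤) =
  let M , x-at = nonZeroᵣ-at x (½*-pos ε⁺)
      N , y-at = nonZeroᵣ-at y (½*-pos ε⁺)
      m = K ⊔ (M ⊔ N)
      M⊔N≤m = ℕP.m≤n⊔m K (M ⊔ N)
  in [ (λ x≥ → inj₁ (x-at m (ℕP.≤-trans (ℕP.m≤m⊔n M N) M⊔N≤m) x≥))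
     , (λ y≥ → inj₂ (y-at m (ℕP.≤-trans (ℕP.m≤n⊔m M N) M⊔N≤m) y≥))
     ]′ (half-of-sum (seq x m) (seq y m) (ε≤ m (ℕP.m≤m⊔n K (M ⊔ N))))

nonZeroᵣ-sumOfSquares : ∀ {x y} → NonZeroᵣ x → NonZeroᵣ (x *ᵣ x +ᵣ y *ᵣ y)
nonZeroᵣ-sumOfSquares {x} {y} x#0 =
  let ε , ε⁺ , ε≤ = nonZeroᵣ-* {x} {x} x#0 x#0
  in ε , ε⁺ , eventually-map (λ {n} ε≤x² → begin
    ε                                        ≤⟨ ε≤x² ⟩
    ℚ.∣ seq x n ℚ.* seq x n ∣                ≡⟨ ℚP.0≤p⇒∣p∣≡p (square≥0 (seq x n)) ⟩
    seq x n ℚ.* seq x n                      ≡⟨ ℚP.+-identityʳ _ ⟨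
    seq x n ℚ.* seq x n ℚ.+ 0ℚ               ≤⟨ ℚP.+-monoʳ-≤ (seq x n ℚ.* seq x n) (square≥0 (seq y n)) ⟩
    seq x n ℚ.* seq x n ℚ.+ seq y n ℚ.* seq y n
      ≡⟨ ℚP.0≤p⇒∣p∣≡p (ℚP.+-mono-≤ (square≥0 (seq x n)) (square≥0 (seq y n))) ⟨
    ℚ.∣ seq x n ℚ.* seq x n ℚ.+ seq y n ℚ.* seq y n ∣ ∎) ε≤
  where
  open ℚP.≤-Reasoning
  square≥0 : ∀ p → 0ℚ ℚ.≤ p ℚ.* p
  square≥0 p with ℚP.≤-total 0ℚ p
  ... | inj₁ 0≤p = ℚP.nonNegative⁻¹ _ {{ℚP.nonNeg*nonNeg⇒nonNeg p {{ℚ.nonNegative 0≤p}} p {{ℚ.nonNegative 0≤p}}}}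
  ... | inj₂ p≤0 = ℚP.nonNegative⁻¹ _ {{ℚP.nonPos*nonPos⇒nonPos p {{ℚ.nonPositive p≤0}} p {{ℚ.nonPositive p≤0}}}}

nonZeroᵣ-1≤ : ∀ x → (∀ n → 1ℚ ℚ.≤ seq x n) → NonZeroᵣ x
nonZeroᵣ-1≤ x 1≤x = 1ℚ , ℚP.positive⁻¹ 1ℚ , 0 , λ n _ →
  ℚP.≤-trans (1≤x n) (ℚP.≤-reflexive (≡.sym (ℚP.0≤p⇒∣p∣≡p
    (ℚP.≤-trans (ℚP.nonNegative⁻¹ 1ℚ) (1≤x n)))))

-- Complex numbers

infix 8 -ℂ_

-ℂ_ : ℂ → ℂ
-ℂ z = (-ᵣ re z) +i (-ᵣ im z)

1ℂ : ℂ
1ℂ = constᵣ 1ℚ +i 0ᵣ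

module ℝ-Ring = CommutativeRing ℝ-commutativeRing
module ℝ-Complexification = Complexification ℝ-commutativeRing

ℂ-commutativeRing : CommutativeRing 0ℓ 0ℓ
ℂ-commutativeRing = record
  { Carrier = ℂ
  ; _≈_ = ℂ._≈_
  ; _+_ = ℂ._+_
  ; _*_ = ℂ._*_
  ; -_  = -ℂ_
  ; 0#  = 0ℂ
  ; 1#  = 1ℂ
  ; isCommutativeRing = record
    { isRing = record
      { +-isAbelianGroup = record
        { isGroup = record
          { isMonoid = record
            { isSemigroup = record
              { isMagma = record
                { isEquivalence = isEquivalence
                ; ∙-cong = λ {z} {z′} {w} {w′} (p , p′) (q , q′) →
                    +ᵣ-cong {re z} {re z′} {re w} {re w′} p q ,
                    +ᵣ-cong {im z} {im z′} {im w} {im w′} p′ q′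
                }
              ; assoc = λ x y z →
                  ℝ-Ring.+-assoc (re x) (re y) (re z) , ℝ-Ring.+-assoc (im x) (im y) (im z)
              }
            ; identity = (λ x → ℝ-Ring.+-identityˡ (re x) , ℝ-Ring.+-identityˡ (im x))
                       , (λ x → ℝ-Ring.+-identityʳ (re x) , ℝ-Ring.+-identityʳ (im x))
            }
          ; inverse = (λ x → ℝ-Ring.-‿inverseˡ (re x) , ℝ-Ring.-‿inverseˡ (im x))
                    , (λ x → ℝ-Ring.-‿inverseʳ (re x) , ℝ-Ring.-‿inverseʳ (im x))
          ; ⁻¹-cong = λ {z} {z′} (p , p′) → -ᵣ-cong {re z} {re z′} p , -ᵣ-cong {im z} {im z′} p′
          }
        ; comm = λ x y → ℝ-Ring.+-comm (re x) (re y) , ℝ-Ring.+-comm (im x) (im y)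
        }
      ; *-cong = λ {z} {z′} {w} {w′} → *-cong z z′ w w′
      ; *-assoc = λ z w v →
          ℝ-Complexification.re-assoc (re z) (im z) (re w) (im w) (re v) (im v) ,
          ℝ-Complexification.im-assoc (re z) (im z) (re w) (im w) (re v) (im v)
      ; *-identity = comm∧idˡ⇒id {_∙_ = ℂ._*_} *-comm {1ℂ} λ z →
          ℝ-Complexification.re-identityˡ (re z) (im z) , ℝ-Complexification.im-identityˡ (re z) (im z)
      ; distrib = comm∧distrˡ⇒distr {_∙_ = ℂ._*_} {_◦_ = ℂ._+_}
          (λ {z} {z′} {w} {w′} (p , p′) (q , q′) →
            +ᵣ-cong {re z} {re z′} {re w} {re w′} p q ,
            +ᵣ-cong {im z} {im z′} {im w} {im w′} p′ q′)
          *-comm λ z w v →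
          ℝ-Complexification.re-distribˡ (re z) (im z) (re w) (im w) (re v) (im v) ,
          ℝ-Complexification.im-distribˡ (re z) (im z) (re w) (im w) (re v) (im v)
      }
    ; *-comm = *-comm
    }
  }
  where
  isEquivalence : IsEquivalence ℂ._≈_
  isEquivalence = record
    { refl  = λ {z} → ℝ-Ring.refl {re z} , ℝ-Ring.refl {im z}
    ; sym   = λ {z} {w} (p , q) → ≈ᵣ-sym {re z} {re w} p , ≈ᵣ-sym {im z} {im w} q
    ; trans = λ {z} {w} {v} (p , p′) (q , q′) →
        ≈ᵣ-trans {re z} {re w} {re v} p q , ≈ᵣ-trans {im z} {im w} {im v} p′ q′
    }
  setoid : Setoid 0ℓ 0ℓ
  setoid = record { isEquivalence = isEquivalence }
  open SetoidConsequences setoid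
    using (comm∧idˡ⇒id; comm∧distrˡ⇒distr)
  *-comm : ∀ z w → z ℂ.* w ℂ.≈ w ℂ.* z
  *-comm z w = ℝ-Complexification.re-comm (re z) (im z) (re w) (im w)
             , ℝ-Complexification.im-comm (re z) (im z) (re w) (im w)
  *-cong : ∀ z z′ w w′ → z ℂ.≈ z′ → w ℂ.≈ w′ → z ℂ.* w ℂ.≈ z′ ℂ.* w′
  *-cong z z′ w w′ (p , p′) (q , q′) =
      +ᵣ-cong {re z *ᵣ re w} {re z′ *ᵣ re w′} { -ᵣ (im z *ᵣ im w)} { -ᵣ (im z′ *ᵣ im w′)}
        (*ᵣ-cong {re z} {re z′} {re w} {re w′} p q)
        (-ᵣ-cong {im z *ᵣ im w} {im z′ *ᵣ im w′} (*ᵣ-cong {im z} {im z′} {im w} {im w′} p′ q′))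
    , +ᵣ-cong {re z *ᵣ im w} {re z′ *ᵣ im w′} {im z *ᵣ re w} {im z′ *ᵣ re w′}
        (*ᵣ-cong {re z} {re z′} {im w} {im w′} p q′)
        (*ᵣ-cong {im z} {im z′} {re w} {re w′} p′ q)

-- The squared modulus. It is multiplicative and is nonzero exactly when the number is, so the
-- product laws of `NonZeroℂ` reduce to those of ℝ.
norm : ℂ → ℝ
norm z = re z *ᵣ re z +ᵣ im z *ᵣ im z

norm-* : ∀ z w → norm z *ᵣ norm w ≈ᵣ norm (z ℂ.* w)
norm-* z w = ℝ-Complexification.norm-* (re z) (im z) (re w) (im w)

-- z ℂ.# w is by definition NonZeroℂ (z ℂ.+ -ℂ w).
NonZeroℂ : ℂ → Set
NonZeroℂ z = NonZeroᵣ (re z) ⊎ NonZeroᵣ (im z)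

nonZero⇒norm : ∀ z → NonZeroℂ z → NonZeroᵣ (norm z)
nonZero⇒norm z (inj₁ x#0) = nonZeroᵣ-sumOfSquares {re z} {im z} x#0
nonZero⇒norm z (inj₂ y#0) = nonZeroᵣ-resp {im z *ᵣ im z +ᵣ re z *ᵣ re z} {norm z}
  (ℝ-Ring.+-comm (im z *ᵣ im z) (re z *ᵣ re z)) (nonZeroᵣ-sumOfSquares {im z} {re z} y#0)

norm⇒nonZero : ∀ z → NonZeroᵣ (norm z) → NonZeroℂ z
norm⇒nonZero z = Sum.map (nonZeroᵣ-*⁻ʳ {re z} {re z}) (nonZeroᵣ-*⁻ʳ {im z} {im z})
  ∘ nonZeroᵣ-+ {re z *ᵣ re z} {im z *ᵣ im z}

ℂ-apartnessRing : ApartnessRing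
ℂ-apartnessRing = record
  { commutativeRing = ℂ-commutativeRing
  ; NonZero = NonZeroℂ
  ; nonZero-resp = λ {z} {w} (p , q) →
      Sum.map (nonZeroᵣ-resp {re z} {re w} p) (nonZeroᵣ-resp {im z} {im w} q)
  ; nonZero-* = λ {z} {w} z#0 w#0 → norm⇒nonZero (z ℂ.* w)
      (nonZeroᵣ-resp {norm z *ᵣ norm w} {norm (z ℂ.* w)} (norm-* z w)
        (nonZeroᵣ-* {norm z} {norm w} (nonZero⇒norm z z#0) (nonZero⇒norm w w#0)))
  ; nonZero-*⁻ʳ = λ {z} {w} zw#0 → norm⇒nonZero w (nonZeroᵣ-*⁻ʳ {norm z} {norm w}
      (nonZeroᵣ-resp {norm (z ℂ.* w)} {norm z *ᵣ norm w}
        (≈ᵣ-sym {norm z *ᵣ norm w} {norm (z ℂ.* w)} (norm-* z w))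
        (nonZero⇒norm (z ℂ.* w) zw#0)))
  ; nonZero-+ = λ {z} {w} → [ Sum.map inj₁ inj₁ ∘ nonZeroᵣ-+ {re z} {re w}
                            , Sum.map inj₂ inj₂ ∘ nonZeroᵣ-+ {im z} {im w} ]′
  ; nonZero-suc· = λ n → inj₁ (nonZeroᵣ-1≤ (re (suc n · 1ℂ)) (1≤re-suc· n))
  }
  where
  open SemiringMult (CommutativeRing.semiring ℂ-commutativeRing) using () renaming (_×_ to _·_)
  0≤re-· : ∀ n k → 0ℚ ℚ.≤ seq (re (n · 1ℂ)) k
  0≤re-· zero    k = ℚP.≤-refl
  0≤re-· (suc n) k = ℚP.+-mono-≤ (ℚP.nonNegative⁻¹ 1ℚ) (0≤re-· n k)
  1≤re-suc· : ∀ n k → 1ℚ ℚ.≤ seq (re (suc n · 1ℂ)) k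
  1≤re-suc· n k = ℚP.+-monoʳ-≤ 1ℚ (0≤re-· n k)

private variable
  n : ℕ

-- Finite sets and graphs

x∈p─q⇒x∉q : ∀ {x : Fin n} (p q : Subset n) → x ∈ p ─ q → x ∉ q
x∈p─q⇒x∉q (_ ∷ p) (_ ∷ q) (there x∈) (there x∈q) = x∈p─q⇒x∉q p q x∈ x∈q
x∈p─q⇒x∉q (_ ∷ p) (_ ∷ q) () here

∣p∣<∣q∣⇒∃∈q∖p : (p q : Subset n) → ∣ p ∣ ℕ.< ∣ q ∣ → ∃[ x ] (x ∈ q × x ∉ p)
∣p∣<∣q∣⇒∃∈q∖p p q p<q with FinP.any? (λ x → (x ∈? q) ×-dec ¬? (x ∈? p))
... | yes found = found
... | no  none  = contradiction
  (p⊆q⇒∣p∣≤∣q∣ λ {x} x∈q → decidable-stable (x ∈? p) λ x∉p → none (x , x∈q , x∉p))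
  (ℕP.<⇒≱ p<q)

∃distinct₂ : ∀ {n} (S : Subset n) → 3 ℕ.≤ ∣ S ∣ → ∃[ p ] ∃[ q ] (p ∈ S × q ∈ S × p ≢ q)
∃distinct₂ {n} S 3≤ with ∣p∣<∣q∣⇒∃∈q∖p ⊥ S
  (ℕP.≤-trans (s≤s (ℕP.≤-reflexive (∣⊥∣≡0 n))) (ℕP.≤-trans (s≤s z≤n) 3≤))
... | p , p∈S , _ with ∣p∣<∣q∣⇒∃∈q∖p ⁅ p ⁆ S
  (ℕP.≤-trans (s≤s (ℕP.≤-reflexive (∣⁅x⁆∣≡1 p))) (ℕP.≤-trans (s≤s (s≤s z≤n)) 3≤))
...   | q , q∈S , q∉p = p , q , p∈S , q∈S , λ { ≡.refl → q∉p (x∈⁅x⁆ p) }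

∣p∪q∣≤∣p∣+∣q∣ : ∀ {n} (p q : Subset n) → ∣ p ∪ q ∣ ℕ.≤ ∣ p ∣ ℕ.+ ∣ q ∣
∣p∪q∣≤∣p∣+∣q∣ []            []            = z≤n
∣p∪q∣≤∣p∣+∣q∣ (outside ∷ p) (outside ∷ q) = ∣p∪q∣≤∣p∣+∣q∣ p q
∣p∪q∣≤∣p∣+∣q∣ (inside  ∷ p) (outside ∷ q) = s≤s (∣p∪q∣≤∣p∣+∣q∣ p q)
∣p∪q∣≤∣p∣+∣q∣ (outside ∷ p) (inside  ∷ q) =
  ℕP.≤-trans (s≤s (∣p∪q∣≤∣p∣+∣q∣ p q)) (ℕP.≤-reflexive (≡.sym (ℕP.+-suc ∣ p ∣ ∣ q ∣)))
∣p∪q∣≤∣p∣+∣q∣ (inside  ∷ p) (inside  ∷ q) =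
  s≤s (ℕP.≤-trans (∣p∪q∣≤∣p∣+∣q∣ p q) (ℕP.+-monoʳ-≤ ∣ p ∣ (ℕP.n≤1+n ∣ q ∣)))

∃third : ∀ {n} (S : Subset n) → 3 ℕ.≤ ∣ S ∣ → ∀ p q → ∃[ r ] (r ∈ S × p ≢ r × q ≢ r)
∃third S 3≤ p q =
  let r , r∈S , r∉ = ∣p∣<∣q∣⇒∃∈q∖p (⁅ p ⁆ ∪ ⁅ q ⁆) S (ℕP.≤-trans (s≤s ∣p∪q∣≤2) 3≤)
  in r , r∈S , (λ p≡r → r∉ (≡.subst (_∈ ⁅ p ⁆ ∪ ⁅ q ⁆) p≡r (x∈p∪q⁺ (inj₁ (x∈⁅x⁆ p)))))
             , (λ q≡r → r∉ (≡.subst (_∈ ⁅ p ⁆ ∪ ⁅ q ⁆) q≡r (x∈p∪q⁺ (inj₂ (x∈⁅x⁆ q)))))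
  where
  ∣p∪q∣≤2 : ∣ ⁅ p ⁆ ∪ ⁅ q ⁆ ∣ ℕ.≤ 2
  ∣p∪q∣≤2 = ℕP.≤-trans (∣p∪q∣≤∣p∣+∣q∣ ⁅ p ⁆ ⁅ q ⁆)
    (ℕP.≤-reflexive (≡.cong₂ ℕ._+_ (∣⁅x⁆∣≡1 p) (∣⁅x⁆∣≡1 q)))

-- A shortest closed piece of a walk without backtracking is a cycle.

module _ {E : Fin n → Fin n → Set} (irrefl : ∀ {x} → ¬ E x x)
         (w : ℕ → Fin n) (walk : ∀ i → E (w i) (w (suc i)))
         (no-backtrack : ∀ i → w (suc (suc i)) ≢ w i) where

  private
    piece : ∀ {k} → ℕ → Fin k → Fin n
    piece i a = w (i ℕ.+ toℕ a)

  -- The closed piece has length `suc d`. Length one contradicts irreflexivity and length two is a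
  -- backtrack. Otherwise compare the vertices at offsets 0 to k + 2, leaving out the closing one: a
  -- repetition among them bounds a strictly shorter closed piece, and without one the piece is a
  -- cycle.
  closed⇒cycle : ∀ d → Acc ℕ._<_ d → ∀ i → w (i ℕ.+ suc d) ≡ w i → Cycle E
  closed⇒cycle zero _ i closed = contradiction
    (≡.subst (λ x → E (w i) x) (≡.trans (≡.cong w (ℕP.+-comm 1 i)) closed) (walk i)) irrefl
  closed⇒cycle (suc zero) _ i closed = contradiction
    (≡.trans (≡.cong w (ℕP.+-comm 2 i)) closed) (no-backtrack i)
  closed⇒cycle (suc (suc k)) (acc rec) i closed
    with FinP.any? {3 ℕ.+ k} (λ a → FinP.any? {3 ℕ.+ k} λ b →
           (a FinP.<? b) ×-dec (piece i a FinP.≟ piece i b))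
  ... | yes (a , b , a<b , eq) with ℕP.m≤n⇒∃[o]m+o≡n a<b
  ...   | d , 1+a+d≡b = closed⇒cycle d (rec d<2+k) (i ℕ.+ toℕ a)
            (≡.trans (≡.cong w (≡.trans (ℕP.+-assoc i (toℕ a) (suc d))
              (≡.cong (i ℕ.+_) (≡.trans (ℕP.+-suc (toℕ a) d) 1+a+d≡b)))) (≡.sym eq))
    where
    d<2+k : d ℕ.< 2 ℕ.+ k
    d<2+k = ℕP.≤-trans (s≤s (ℕP.m≤n+m d (toℕ a)))
      (ℕP.≤-trans (ℕP.≤-reflexive 1+a+d≡b) (FinP.toℕ≤pred[n] b))
  closed⇒cycle (suc (suc k)) (acc rec) i closed | no distinct = record
    { k        = k
    ; vertex   = piece i
    ; distinct = injective
    ; step     = λ a → ≡.subst (λ m → E (w (i ℕ.+ toℕ (inject₁ a))) (w m))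
        (≡.trans (≡.sym (ℕP.+-suc i _)) (≡.cong (λ m → i ℕ.+ suc m) (FinP.toℕ-inject₁ a)))
        (walk (i ℕ.+ toℕ (inject₁ a)))
    ; close    = ≡.subst (E (piece i (fromℕ (2 ℕ.+ k))))
        (≡.trans (≡.cong w (≡.trans (≡.sym (ℕP.+-suc i _)) (≡.cong (λ m → i ℕ.+ suc m) (FinP.toℕ-fromℕ (2 ℕ.+ k)))))
          (≡.trans closed (≡.cong w (≡.sym (ℕP.+-identityʳ i)))))
        (walk (i ℕ.+ toℕ (fromℕ (2 ℕ.+ k))))
    }
    where
    injective : Injective _≡_ _≡_ (piece i)
    injective {a} {b} eq with FinP.<-cmp a b
    ... | tri< a<b _ _ = contradiction (a , b , a<b , eq) distinct
    ... | tri≈ _ a≡b _ = a≡b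
    ... | tri> _ _ b<a = contradiction (b , a , b<a , ≡.sym eq) distinct

  walk⇒cycle : Cycle E
  walk⇒cycle with FinP.pigeonhole (ℕP.n<1+n n) (w ∘ toℕ)
  ... | a , b , a<b , eq with ℕP.m≤n⇒∃[o]m+o≡n a<b
  ...   | d , 1+a+d≡b = closed⇒cycle d (ℕI.<-wellFounded d) (toℕ a)
            (≡.trans (≡.cong w (≡.trans (ℕP.+-suc (toℕ a) d) 1+a+d≡b)) (≡.sym eq))

module _ {E : Fin n → Fin n → Set} (irrefl : ∀ {x} → ¬ E x x)
         (branch : ∀ {u v} → E u v → ∃[ x ] (E v x × x ≢ u)) where

  private
    -- The walk is iterated on edges, because avoiding a backtrack depends on the previous vertex as
    -- well as on the current one.
    Edge : Set
    Edge = Σ[ u ∈ Fin n ] ∃[ v ] E u v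

    advance : Edge → Edge
    advance (_ , v , e) = let x , e′ , _ = branch e in v , x , e′

    edge : Edge → ℕ → Edge
    edge e zero    = e
    edge e (suc i) = advance (edge e i)

  branching⇒cycle : ∀ {u v} → E u v → Cycle E
  branching⇒cycle {u} {v} e = walk⇒cycle irrefl (λ i → proj₁ (edge (u , v , e) i))
    (λ i → proj₂ (proj₂ (edge (u , v , e) i)))
    (λ i → proj₂ (proj₂ (branch (proj₂ (proj₂ (edge (u , v , e) i))))))

-- Degree at most one: a vertex without neighbours counts as a leaf.
Leaf : (Fin n → Fin n → Set) → Fin n → Set
Leaf E v = ∀ x y → E v x → E v y → x ≡ y

-- If no vertex in `P` were a leaf, each would have two neighbours, one of them different from the
-- vertex just left, so a walk that starts in `P` could go on forever without backtracking.
-- Decidability turns this refutation into an actual leaf.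
acyclic⇒leaf : {E : Fin n → Fin n → Set} → (∀ {x} → ¬ E x x) → Decidable E →
               {P : Fin n → Set} → Unary.Decidable P → (∀ {x y} → E x y → P y) →
               ∃[ v ] P v → ¬ Cycle E → ∃[ v ] (P v × Leaf E v)
acyclic⇒leaf {n} {E} irrefl E? {P} P? closed (v₀ , Pv₀) acyclic
  with FinP.any? (λ v → P? v ×-dec
         FinP.all? λ x → FinP.all? λ y → E? v x →-dec (E? v y →-dec (x FinP.≟ y)))
... | yes found = found
... | no  none  = contradiction cycle acyclic
  where
  two-neighbours : ∀ {v} → P v → ∃[ x ] ∃[ y ] (E v x × E v y × x ≢ y)
  two-neighbours {v} Pv with FinP.any? (λ x → FinP.any? λ y → E? v x ×-dec (E? v y ×-dec ¬? (x FinP.≟ y)))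
  ... | yes found = found
  ... | no  ¬two  = contradiction (v , Pv , λ x y vx vy →
          decidable-stable (x FinP.≟ y) λ x≢y → ¬two (x , y , vx , vy , x≢y)) none
  branch : ∀ {u v} → E u v → ∃[ x ] (E v x × x ≢ u)
  branch {u} uv with two-neighbours (closed uv)
  ... | x , y , vx , vy , x≢y with x FinP.≟ u
  ...   | no  x≢u  = x , vx , x≢u
  ...   | yes ≡.refl = y , vy , x≢y ∘ ≡.sym
  cycle : Cycle E
  cycle = let x , _ , e , _ = two-neighbours Pv₀ in branching⇒cycle irrefl branch e

module _ {P : Fin n → Set} (P? : Unary.Decidable P) where

  nearest-above : ∀ {v w : Fin n} → v Fin.< w → P w →
    ∃[ x ] (v Fin.< x × P x × ¬ (∃[ k ] (P k × v Fin.< k × k Fin.< x)))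
  nearest-above {v} {w} v<w Pw = go w (FinI.<-wellFounded w) v<w Pw
    where
    go : ∀ w → Acc Fin._<_ w → v Fin.< w → P w →
      ∃[ x ] (v Fin.< x × P x × ¬ (∃[ k ] (P k × v Fin.< k × k Fin.< x)))
    go w (acc rec) v<w Pw with FinP.any? (λ k → P? k ×-dec ((v FinP.<? k) ×-dec (k FinP.<? w)))
    ... | no  none = w , v<w , Pw , none
    ... | yes (k , Pk , v<k , k<w) = go k (rec k<w) v<k Pk

  nearest-below : ∀ {v w : Fin n} → w Fin.< v → P w →
    ∃[ x ] (x Fin.< v × P x × ¬ (∃[ k ] (P k × x Fin.< k × k Fin.< v)))
  nearest-below {v} {w} w<v Pw = go w (FinI.>-wellFounded w) w<v Pw
    where
    go : ∀ w → Acc Fin._>_ w → w Fin.< v → P w →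
      ∃[ x ] (x Fin.< v × P x × ¬ (∃[ k ] (P k × x Fin.< k × k Fin.< v)))
    go w (acc rec) w<v Pw with FinP.any? (λ k → P? k ×-dec ((w FinP.<? k) ×-dec (k FinP.<? v)))
    ... | no  none = w , w<v , Pw , none
    ... | yes (k , Pk , w<k , k<v) = go k (rec w<k) k<v Pk

-- Leaf lines of forest configurations

module Combinatorics {n : ℕ} (C : Configuration n) where

  open Configuration C

  Coll : Fin n → Fin n → Fin n → Set
  Coll p q r = ∃[ l ] (p ∈ line l × q ∈ line l × r ∈ line l)

  Coll? : ∀ p q r → Dec (Coll p q r)
  Coll? p q r = FinP.any? λ l → (p ∈? line l) ×-dec ((q ∈? line l) ×-dec (r ∈? line l))

  -- Consecutive means consecutive among the points of A, so that removing a point may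
  -- create an edge; removing a leaf does not.

  NextIn : Subset n → Fin n → Fin n → Set
  NextIn A p q = p Fin.< q × (p ∈ A × q ∈ A) × ∃[ l ] ((p ∈ line l × q ∈ line l) ×
    ¬ (∃[ k ] ((k ∈ A × k ∈ line l) × p Fin.< k × k Fin.< q)))

  AdjacentIn : Subset n → Fin n → Fin n → Set
  AdjacentIn A p q = NextIn A p q ⊎ NextIn A q p

  nextIn? : ∀ A → Decidable (NextIn A)
  nextIn? A p q = (p FinP.<? q) ×-dec (((p ∈? A) ×-dec (q ∈? A)) ×-dec FinP.any? λ l →
    ((p ∈? line l) ×-dec (q ∈? line l)) ×-dec
    ¬? (FinP.any? λ k → ((k ∈? A) ×-dec (k ∈? line l)) ×-dec ((p FinP.<? k) ×-dec (k FinP.<? q))))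

  adjacentIn? : ∀ A → Decidable (AdjacentIn A)
  adjacentIn? A p q = nextIn? A p q ⊎-dec nextIn? A q p

  adjacentIn-irrefl : ∀ A {x} → ¬ AdjacentIn A x x
  adjacentIn-irrefl A = [ ℕP.<-irrefl ≡.refl ∘ proj₁ , ℕP.<-irrefl ≡.refl ∘ proj₁ ]′

  adjacentIn⇒∈ : ∀ A {x y} → AdjacentIn A x y → y ∈ A
  adjacentIn⇒∈ A (inj₁ (_ , (_ , y∈A) , _)) = y∈A
  adjacentIn⇒∈ A (inj₂ (_ , (y∈A , _) , _)) = y∈A

  module _ {A : Subset n} {l} {v} (v∈A : v ∈ A) (v∈l : v ∈ line l) where

    private
      on? : ∀ k → Dec (k ∈ A × k ∈ line l)
      on? k = (k ∈? A) ×-dec (k ∈? line l)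

    neighbour-above : ∀ {w} → v Fin.< w → w ∈ A → w ∈ line l →
                      ∃[ x ] (v Fin.< x × x ∈ line l × AdjacentIn A v x)
    neighbour-above v<w w∈A w∈l =
      let x , v<x , (x∈A , x∈l) , none = nearest-above on? v<w (w∈A , w∈l)
      in x , v<x , x∈l , inj₁ (v<x , (v∈A , x∈A) , l , (v∈l , x∈l) , none)

    neighbour-below : ∀ {w} → w Fin.< v → w ∈ A → w ∈ line l →
                      ∃[ x ] (x Fin.< v × x ∈ line l × AdjacentIn A v x)
    neighbour-below w<v w∈A w∈l =
      let x , x<v , (x∈A , x∈l) , none = nearest-below on? w<v (w∈A , w∈l)
      in x , x<v , x∈l , inj₂ (x<v , (x∈A , v∈A) , l , (x∈l , v∈l) , none)

    neighbour : ∀ {w} → w ≢ v → w ∈ A → w ∈ line l → ∃[ x ] (x ≢ v × x ∈ line l × AdjacentIn A v x)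
    neighbour {w} w≢v w∈A w∈l with FinP.<-cmp v w
    ... | tri≈ _ v≡w _ = contradiction (≡.sym v≡w) w≢v
    ... | tri< v<w _ _ = let x , v<x , rest = neighbour-above v<w w∈A w∈l
                         in x , (λ x≡v → FinP.<⇒≢ v<x (≡.sym x≡v)) , rest
    ... | tri> _ _ w<v = let x , x<v , rest = neighbour-below w<v w∈A w∈l
                         in x , FinP.<⇒≢ x<v , rest

  OnlyOn : (Fin n → Set) → Fin n → Fin #lines → Set
  OnlyOn B s l = ∀ {y} → B y → y ∈ line l → y ≡ s

  -- Phrased through pairs of lines, so that it also covers a point none of whose lines meets `B`
  -- again.
  AtMostOneLine : (Fin n → Set) → Fin n → Set
  AtMostOneLine B s = ∀ {k l} → s ∈ line k → s ∈ line l → k ≢ l → OnlyOn B s k ⊎ OnlyOn B s l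

  -- If two lines through `v` both carried further points of `B`, then `v` would have a neighbour
  -- along each. The leaf property identifies the two neighbours, and linearity then identifies the
  -- lines.
  leaf⇒atMostOneLine : ∀ {A v} {B : Fin n → Set} → (∀ {x} → B x → x ∈ A) → v ∈ A →
                       Leaf (AdjacentIn A) v → Unary.Decidable B → AtMostOneLine B v
  leaf⇒atMostOneLine {A} {v} {B} B⊆A v∈A leaf B? {k} {l} v∈k v∈l k≢l
    with FinP.any? (λ y → B? y ×-dec ((y ∈? line k) ×-dec ¬? (y FinP.≟ v)))
  ... | no none = inj₁ λ {y} By y∈k →
    decidable-stable (y FinP.≟ v) λ y≢v → none (y , By , y∈k , y≢v)
  ... | yes (y , By , y∈k , y≢v) = inj₂ λ {z} Bz z∈l → decidable-stable (z FinP.≟ v) λ z≢v →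
    let x  , x≢v , x∈k , vx = neighbour v∈A v∈k y≢v (B⊆A By) y∈k
        x′ , _ , x′∈l , vx′ = neighbour v∈A v∈l z≢v (B⊆A Bz) z∈l
        x∈l = ≡.subst (_∈ line l) (leaf x′ x vx′ vx) x′∈l
    in k≢l (linear x≢v k l x∈k v∈k x∈l v∈l)

  module _ {A : Subset n} {v} (v∈A : v ∈ A) (leaf : Leaf (AdjacentIn A) v) where

    -- A new edge could only bridge the gap left by `v`. But then `v` had a neighbour on either side
    -- along that line, which a leaf does not.
    nextIn-remove : ∀ {p q} → NextIn (A ∖ v) p q → NextIn A p q
    nextIn-remove {p} {q} (p<q , (p∈ , q∈) , l , (p∈l , q∈l) , none) =
      p<q , (⊆A p∈ , ⊆A q∈) , l , (p∈l , q∈l) , none′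
      where
      ⊆A : A ∖ v ⊆ A
      ⊆A = p─q⊆p A ⁅ v ⁆
      none′ : ¬ (∃[ k ] ((k ∈ A × k ∈ line l) × p Fin.< k × k Fin.< q))
      none′ (k , (k∈A , k∈l) , p<k , k<q) with k FinP.≟ v
      ... | no  k≢v  = none (k , (x∈p∧x≢y⇒x∈p-y k∈A k≢v , k∈l) , p<k , k<q)
      ... | yes ≡.refl =
        let x , x<v , _ , vx = neighbour-below v∈A k∈l p<k (⊆A p∈) p∈l
            y , v<y , _ , vy = neighbour-above v∈A k∈l k<q (⊆A q∈) q∈l
        in FinP.<⇒≢ (FinP.<-trans x<v v<y) (leaf x y vx vy)

    cycle-remove : Cycle (AdjacentIn (A ∖ v)) → Cycle (AdjacentIn A)
    cycle-remove c = record
      { k = Cycle.k c ; vertex = Cycle.vertex c ; distinct = Cycle.distinct c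
      ; step = Sum.map nextIn-remove nextIn-remove ∘ Cycle.step c
      ; close = Sum.map nextIn-remove nextIn-remove (Cycle.close c)
      }

  module Elimination (B : Fin n → Set) (B? : Unary.Decidable B) where

    -- A leaf outside `B` is deleted, which preserves acyclicity. Since `A` shrinks while still
    -- containing the inhabited `B`, some leaf eventually lies in `B`.
    eliminate : ∀ A → Acc _⊂_ A → ¬ Cycle (AdjacentIn A) → (∀ {x} → B x → x ∈ A) →
                ∃[ b ] B b → ∃[ s ] (B s × AtMostOneLine B s)
    eliminate A (acc rec) acyclic B⊆A (b , Bb)
      with acyclic⇒leaf (adjacentIn-irrefl A) (adjacentIn? A) (_∈? A) (adjacentIn⇒∈ A)
             (b , B⊆A Bb) acyclic
    ... | v , v∈A , leaf with B? v
    ...   | yes Bv = v , Bv , leaf⇒atMostOneLine B⊆A v∈A leaf B?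
    ...   | no ¬Bv = eliminate (A ∖ v) (rec (x∈p⇒p-x⊂p v∈A)) (acyclic ∘ cycle-remove v∈A leaf)
      (λ Bx → x∈p∧x≢y⇒x∈p-y (B⊆A Bx) λ { ≡.refl → ¬Bv Bx }) (b , Bb)

  Proper : Subset n → Fin #lines → Fin n → Set
  Proper A l s = s ∈ line l × ∃[ x ] (x ∈ A × x ∈ line l × x ≢ s)

  proper? : ∀ A l s → Dec (Proper A l s)
  proper? A l s = (s ∈? line l) ×-dec
    FinP.any? λ x → (x ∈? A) ×-dec ((x ∈? line l) ×-dec ¬? (x FinP.≟ s))

  Branch : Subset n → Fin n → Set
  Branch A s = s ∈ A × ∃[ k ] ∃[ l ] (k ≢ l × Proper A k s × Proper A l s)

  branch? : ∀ A s → Dec (Branch A s)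
  branch? A s = (s ∈? A) ×-dec FinP.any? λ k → FinP.any? λ l →
    ¬? (k FinP.≟ l) ×-dec (proper? A k s ×-dec proper? A l s)

  Isolated : Subset n → Fin n → Set
  Isolated A v = v ∈ A × (∀ {l} → v ∈ line l → OnlyOn (_∈ A) v l)

  LeafLine : Subset n → Fin #lines → Fin n → Set
  LeafLine A l s = Proper A l s ×
    (∀ {x m} → x ∈ A → x ∈ line l → x ≢ s → x ∈ line m → m ≢ l → OnlyOn (_∈ A) x m)

  -- A point other than `s` that met `A` again on a second line would be a branch point, because `s`
  -- already accompanies it on `l`.
  leafLine : ∀ {A l s} → s ∈ A → Proper A l s →
             (∀ {x} → x ∈ line l → x ≢ s → ¬ Branch A x) → LeafLine A l s
  leafLine s∈A proper@(s∈l , _) no-branch = proper , λ {x} {m} x∈A x∈l x≢s x∈m m≢l {y} y∈A y∈m →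
    decidable-stable (y FinP.≟ x) λ y≢x → no-branch x∈l x≢s
      (x∈A , m , _ , m≢l , (x∈m , y , y∈A , y∈m , y≢x) , (x∈l , _ , s∈A , s∈l , x≢s ∘ ≡.sym))

  module _ (forest : IsForest C) where

    ¬cycle-⊤ : ¬ Cycle (AdjacentIn ⊤)
    ¬cycle-⊤ c = forest record
      { k = Cycle.k c ; vertex = Cycle.vertex c ; distinct = Cycle.distinct c
      ; step = Sum.map consecutive consecutive ∘ Cycle.step c
      ; close = Sum.map consecutive consecutive (Cycle.close c)
      }
      where
      consecutive : ∀ {p q} → NextIn ⊤ p q → Consecutive C p q
      consecutive (p<q , _ , l , (p∈l , q∈l) , none) = p<q , l , p∈l , q∈l ,
        λ (k , k∈l , p<k , k<q) → none (k , (∈⊤ , k∈l) , p<k , k<q)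

    ∃atMostOneLine : {B : Fin n → Set} → Unary.Decidable B → ∃[ b ] B b →
                     ∃[ s ] (B s × AtMostOneLine B s)
    ∃atMostOneLine B? = Elimination.eliminate _ B? ⊤ (⊂-wellFounded ⊤) ¬cycle-⊤ (λ _ → ∈⊤)

    isolatedOrLeafLine : ∀ A → Nonempty A → (∃[ v ] Isolated A v) ⊎ (∃[ l ] ∃[ s ] LeafLine A l s)
    isolatedOrLeafLine A (v , v∈A) with FinP.any? (branch? A)
    ... | yes branches with ∃atMostOneLine (branch? A) branches
    ...   | s , (s∈A , k , l , k≢l , proper-k@(s∈k , _) , proper-l@(s∈l , _)) , atMostOne
          with atMostOne s∈k s∈l k≢l
    -- Of the two lines through the branch point `s`, the one without any other branch point is the
    -- leaf line.
    ...     | inj₁ only = inj₂ (k , s , leafLine s∈A proper-k λ x∈k x≢s b → x≢s (only b x∈k))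
    ...     | inj₂ only = inj₂ (l , s , leafLine s∈A proper-l λ x∈l x≢s b → x≢s (only b x∈l))
    -- Without branch points every line through `v` that meets `A` again is a leaf line, with `v`
    -- itself as `s`; if there is no such line, `v` is isolated.
    isolatedOrLeafLine A (v , v∈A) | no none with FinP.any? (λ l → proper? A l v)
    ... | yes (l , proper) = inj₂ (l , v , leafLine v∈A proper λ {x} _ _ b → none (x , b))
    ... | no  lonely = inj₁ (v , v∈A , λ {l} v∈l {y} y∈A y∈l →
      decidable-stable (y FinP.≟ v) λ y≢v → lonely (l , v∈l , y , y∈A , y∈l , y≢v))

-- Heights

-- The hypothesis is the positive form of "each condition fails at most once", as `P` need not be
-- decidable. The remaining conditions hold jointly at two values, and the first condition admits
-- one of them; the lower bound `N` is what makes the second value different from the first.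
infinitelyOften : ∀ {m} (P : Fin m → ℕ → Set) → (∀ i {s t} → s ℕ.< t → P i s ⊎ P i t) →
                  ∀ N → ∃[ t ] (N ℕ.≤ t × (∀ i → P i t))
infinitelyOften {zero}  P atMostOneFails N = N , ℕP.≤-refl , λ ()
infinitelyOften {suc m} P atMostOneFails N =
  let s , N≤s , rest-s = infinitelyOften (P ∘ suc) (atMostOneFails ∘ suc) N
      t , s<t , rest-t = infinitelyOften (P ∘ suc) (atMostOneFails ∘ suc) (suc s)
  in [ (λ Ps → s , N≤s , λ { zero → Ps ; (suc i) → rest-s i })
     , (λ Pt → t , ℕP.≤-trans N≤s (ℕP.<⇒≤ s<t) , λ { zero → Pt ; (suc i) → rest-t i })
     ]′ (atMostOneFails zero s<t)

-- Plücker relations and linear combinations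

module Brackets (R : CommutativeRing 0ℓ 0ℓ) where

  open CommutativeRing R
  open IntegerRingSolver R

  bracket : (u v u′ v′ : Carrier) → Carrier
  bracket u v u′ v′ = u * v′ - v * u′

  private
    br : ∀ {k} → let P = Polynomial k in P → P → P → P → P
    br u v u′ v′ = u :* v′ :- v :* u′

  bracket-self : ∀ u v → bracket u v u v ≈ 0#
  bracket-self = solve 2 (λ u v → br u v u v := con (+ 0)) refl

  -- The three-term Plücker relation, read here as follows: heights given by a linear form in `u`
  -- and `v` make every three lifted points collinear.
  plücker : ∀ u₀ v₀ u₁ v₁ u₂ v₂ u₃ v₃ →
    bracket u₀ v₀ u₁ v₁ * bracket u₂ v₂ u₃ v₃ + bracket u₀ v₀ u₂ v₂ * bracket u₃ v₃ u₁ v₁ +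
    bracket u₀ v₀ u₃ v₃ * bracket u₁ v₁ u₂ v₂ ≈ 0#
  plücker = solve 8 (λ u₀ v₀ u₁ v₁ u₂ v₂ u₃ v₃ →
    br u₀ v₀ u₁ v₁ :* br u₂ v₂ u₃ v₃ :+ br u₀ v₀ u₂ v₂ :* br u₃ v₃ u₁ v₁ :+
    br u₀ v₀ u₃ v₃ :* br u₁ v₁ u₂ v₂ := con (+ 0)) refl

  plücker-scaled : ∀ k u₀ v₀ u₁ v₁ u₂ v₂ u₃ v₃ →
    k * bracket u₁ v₁ u₀ v₀ * bracket u₂ v₂ u₃ v₃ + k * bracket u₂ v₂ u₀ v₀ * bracket u₃ v₃ u₁ v₁ +
    k * bracket u₃ v₃ u₀ v₀ * bracket u₁ v₁ u₂ v₂ ≈ 0#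
  plücker-scaled = solve 9 (λ k u₀ v₀ u₁ v₁ u₂ v₂ u₃ v₃ →
    k :* br u₁ v₁ u₀ v₀ :* br u₂ v₂ u₃ v₃ :+ k :* br u₂ v₂ u₀ v₀ :* br u₃ v₃ u₁ v₁ :+
    k :* br u₃ v₃ u₀ v₀ :* br u₁ v₁ u₂ v₂ := con (+ 0)) refl

  -- The Plücker relation with one height replaced by 0: its missing term survives with the opposite
  -- sign. This evaluates the determinant of `d` when exactly one of the three points is not
  -- removed.
  plücker₁ : ∀ u₀ v₀ u₁ v₁ u₂ v₂ u₃ v₃ →
    0# * bracket u₂ v₂ u₃ v₃ + bracket u₀ v₀ u₂ v₂ * bracket u₃ v₃ u₁ v₁ +
    bracket u₀ v₀ u₃ v₃ * bracket u₁ v₁ u₂ v₂ ≈ bracket u₁ v₁ u₀ v₀ * bracket u₂ v₂ u₃ v₃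
  plücker₁ = solve 8 (λ u₀ v₀ u₁ v₁ u₂ v₂ u₃ v₃ →
    con (+ 0) :* br u₂ v₂ u₃ v₃ :+ br u₀ v₀ u₂ v₂ :* br u₃ v₃ u₁ v₁ :+
    br u₀ v₀ u₃ v₃ :* br u₁ v₁ u₂ v₂ := br u₁ v₁ u₀ v₀ :* br u₂ v₂ u₃ v₃) refl

  plücker₂ : ∀ u₀ v₀ u₁ v₁ u₂ v₂ u₃ v₃ →
    bracket u₀ v₀ u₁ v₁ * bracket u₂ v₂ u₃ v₃ + 0# * bracket u₃ v₃ u₁ v₁ +
    bracket u₀ v₀ u₃ v₃ * bracket u₁ v₁ u₂ v₂ ≈ bracket u₂ v₂ u₀ v₀ * bracket u₃ v₃ u₁ v₁
  plücker₂ = solve 8 (λ u₀ v₀ u₁ v₁ u₂ v₂ u₃ v₃ →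
    br u₀ v₀ u₁ v₁ :* br u₂ v₂ u₃ v₃ :+ con (+ 0) :* br u₃ v₃ u₁ v₁ :+
    br u₀ v₀ u₃ v₃ :* br u₁ v₁ u₂ v₂ := br u₂ v₂ u₀ v₀ :* br u₃ v₃ u₁ v₁) refl

  plücker₃ : ∀ u₀ v₀ u₁ v₁ u₂ v₂ u₃ v₃ →
    bracket u₀ v₀ u₁ v₁ * bracket u₂ v₂ u₃ v₃ + bracket u₀ v₀ u₂ v₂ * bracket u₃ v₃ u₁ v₁ +
    0# * bracket u₁ v₁ u₂ v₂ ≈ bracket u₃ v₃ u₀ v₀ * bracket u₁ v₁ u₂ v₂
  plücker₃ = solve 8 (λ u₀ v₀ u₁ v₁ u₂ v₂ u₃ v₃ →
    br u₀ v₀ u₁ v₁ :* br u₂ v₂ u₃ v₃ :+ br u₀ v₀ u₂ v₂ :* br u₃ v₃ u₁ v₁ :+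
    con (+ 0) :* br u₁ v₁ u₂ v₂ := br u₃ v₃ u₀ v₀ :* br u₁ v₁ u₂ v₂) refl

  combination-linear : ∀ k a b c a′ b′ c′ x y z →
    (a + k * a′) * x + (b + k * b′) * y + (c + k * c′) * z ≈
    (a * x + b * y + c * z) + k * (a′ * x + b′ * y + c′ * z)
  combination-linear = solve 10 (λ k a b c a′ b′ c′ x y z →
    (a :+ k :* a′) :* x :+ (b :+ k :* b′) :* y :+ (c :+ k :* c′) :* z :=
    (a :* x :+ b :* y :+ c :* z) :+ k :* (a′ :* x :+ b′ :* y :+ c′ :* z)) refl

  combination-scale : ∀ k a b c x y z →
    (k * a) * x + (k * b) * y + (k * c) * z ≈ k * (a * x + b * y + c * z)
  combination-scale = solve 7 (λ k a b c x y z →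
    (k :* a) :* x :+ (k :* b) :* y :+ (k :* c) :* z := k :* (a :* x :+ b :* y :+ c :* z)) refl

  combination-0 : ∀ x y z → 0# * x + 0# * y + 0# * z ≈ 0#
  combination-0 = solve 3 (λ x y z →
    con (+ 0) :* x :+ con (+ 0) :* y :+ con (+ 0) :* z := con (+ 0)) refl

  combination-1 : ∀ a x y z → a * x + 0# * y + 0# * z ≈ a * x
  combination-1 = solve 4 (λ a x y z →
    a :* x :+ con (+ 0) :* y :+ con (+ 0) :* z := a :* x) refl

  combination-2 : ∀ a x y z → 0# * x + a * y + 0# * z ≈ a * y
  combination-2 = solve 4 (λ a x y z →
    con (+ 0) :* x :+ a :* y :+ con (+ 0) :* z := a :* y) refl

  combination-3 : ∀ a x y z → 0# * x + 0# * y + a * z ≈ a * z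
  combination-3 = solve 4 (λ a x y z →
    con (+ 0) :* x :+ con (+ 0) :* y :+ a :* z := a :* z) refl

  eliminate-constant : ∀ s k x y → k * y ≈ (x + (s + k) * y) - (x + s * y)
  eliminate-constant = solve 4 (λ s k x y →
    k :* y := (x :+ (s :+ k) :* y) :- (x :+ s :* y)) refl

  eliminate-slope : ∀ s k x y → k * x ≈ (s + k) * (x + s * y) + (- s) * (x + (s + k) * y)
  eliminate-slope = solve 4 (λ s k x y →
    k :* x := (s :+ k) :* (x :+ s :* y) :+ (:- s) :* (x :+ (s :+ k) :* y)) refl

module ApartnessProperties (A : ApartnessRing) where

  open ApartnessRing A
  open Brackets commutativeRing
  open SemiringMult semiring using (×-homo-+)
  open AbelianGroupProperties +-abelianGroup using (⁻¹-involutive)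

  nonZero-neg⁻ : ∀ {x} → NonZero (- x) → NonZero x
  nonZero-neg⁻ {x} = nonZero-*⁻ʳ ∘ nonZero-resp (sym (-1*x≈-x ring x))

  nonZero-neg : ∀ {x} → NonZero x → NonZero (- x)
  nonZero-neg x#0 = nonZero-neg⁻ (nonZero-resp (sym (⁻¹-involutive _)) x#0)

  nonZero-1 : NonZero 1#
  nonZero-1 = nonZero-resp (+-identityʳ 1#) (nonZero-suc· 0)

  -- The values of an affine function at two parameters recover both its slope and its constant
  -- term, up to the factor t - s, which is a nonzero integer. So one of the two values is nonzero
  -- as soon as one coefficient is.
  nonZero-affine : ∀ {x y s t} → NonZero x ⊎ NonZero y → s ℕ.< t →
                   NonZero (x + (s · 1#) * y) ⊎ NonZero (x + (t · 1#) * y)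
  nonZero-affine {x} {y} {s} {t} x⊎y s<t with ℕP.m≤n⇒∃[o]m+o≡n s<t
  ... | k , ≡.refl = Sum.map id (nonZero-resp (+-congˡ (*-congʳ (sym t≈s+k)))) ([ from-x , from-y ]′ x⊎y)
    where
    σ κ : Carrier
    σ = s · 1#
    κ = suc k · 1#
    t≈s+k : (suc s ℕ.+ k) · 1# ≈ σ + κ
    t≈s+k = trans (reflexive (≡.cong (_· 1#) (≡.sym (ℕP.+-suc s k)))) (×-homo-+ 1# s (suc k))
    from-y : NonZero y → NonZero (x + σ * y) ⊎ NonZero (x + (σ + κ) * y)
    from-y y#0 = Sum.swap (Sum.map id nonZero-neg⁻
      (nonZero-+ (nonZero-resp (eliminate-constant σ κ x y) (nonZero-* (nonZero-suc· k) y#0))))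
    from-x : NonZero x → NonZero (x + σ * y) ⊎ NonZero (x + (σ + κ) * y)
    from-x x#0 = Sum.map nonZero-*⁻ʳ nonZero-*⁻ʳ
      (nonZero-+ (nonZero-resp (eliminate-slope σ κ x y) (nonZero-* (nonZero-suc· k) x#0)))

module Heights (A : ApartnessRing) {n : ℕ} (C : Configuration n) (forest : IsForest C)
               (u v : Fin n → ApartnessRing.Carrier A) where

  open ApartnessRing A
  open Brackets commutativeRing
  open ApartnessProperties A
  open Configuration C
  open Combinatorics C

  B : Fin n → Fin n → Carrier
  B p q = bracket (u p) (v p) (u q) (v q)

  -- The determinant with rows h p, u p, v p and so on.
  det : (Fin n → Carrier) → Fin n → Fin n → Fin n → Carrier
  det h p q r = h p * B q r + h q * B r p + h r * B p q

  det-cong : ∀ {h p q r a b c} → h p ≈ a → h q ≈ b → h r ≈ c →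
             det h p q r ≈ a * B q r + b * B r p + c * B p q
  det-cong p≈ q≈ r≈ = +-cong (+-cong (*-congʳ p≈) (*-congʳ q≈)) (*-congʳ r≈)

  Triple : Subset n → Fin n → Fin n → Fin n → Set
  Triple S p q r = (p ∈ S × q ∈ S × r ∈ S) × (p ≢ q × p ≢ r × q ≢ r)

  triple? : ∀ S p q r → Dec (Triple S p q r)
  triple? S p q r = ((p ∈? S) ×-dec ((q ∈? S) ×-dec (r ∈? S))) ×-dec
    (¬? (p FinP.≟ q) ×-dec (¬? (p FinP.≟ r) ×-dec ¬? (q FinP.≟ r)))

  Lifts : Subset n → (Fin n → Carrier) → Set
  Lifts S h = ∀ {p q r} → Triple S p q r →
    (Coll p q r → det h p q r ≈ 0#) × (¬ Coll p q r → NonZero (det h p q r))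

  -- The requirement on a pencil of heights c + t d: the determinant of a collinear triple vanishes
  -- for every t, while that of any other triple is an affine function of t with a nonzero
  -- coefficient.
  LiftsJointly : Subset n → (c d : Fin n → Carrier) → Set
  LiftsJointly S c d = ∀ {p q r} → Triple S p q r →
    (Coll p q r → det c p q r ≈ 0# × det d p q r ≈ 0#) ×
    (¬ Coll p q r → NonZero (det c p q r) ⊎ NonZero (det d p q r))

  generic : ∀ S c d → LiftsJointly S c d → ∃[ h ] Lifts S h
  generic S c d lifts =
    let t , _ , nonDegenerate = infinitelyOften (λ i t → Generic t (decode i)) (λ i → step (decode i)) 0
    in h t , λ {p} {q} {r} pqr →
         (λ coll → let c≈0 , d≈0 = proj₁ (lifts pqr) coll in
           trans (det-h t p q r) (trans (+-cong c≈0 (trans (*-congˡ d≈0) (zeroʳ _))) (+-identityˡ 0#)))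
       , (λ ¬coll → ≡.subst (Generic t) (decode-encode p q r) (nonDegenerate (encode p q r)) pqr ¬coll)
    where
    h : ℕ → Fin n → Carrier
    h t p = c p + (t · 1#) * d p

    det-h : ∀ t p q r → det (h t) p q r ≈ det c p q r + (t · 1#) * det d p q r
    det-h t p q r = combination-linear (t · 1#) (c p) (c q) (c r) (d p) (d q) (d r) (B q r) (B r p) (B p q)

    -- Membership and non-collinearity are premises inside `Generic`, so that it holds vacuously for
    -- irrelevant triples and the conditions can be indexed by all ordered triples.
    Generic : ℕ → Fin n × Fin n × Fin n → Set
    Generic t (p , q , r) = Triple S p q r → ¬ Coll p q r → NonZero (det (h t) p q r)

    step : ∀ pqr {s t} → s ℕ.< t → Generic s pqr ⊎ Generic t pqr
    step (p , q , r) {s} {t} s<t with triple? S p q r | Coll? p q r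
    ... | no ¬pqr | _        = inj₁ λ pqr → contradiction pqr ¬pqr
    ... | yes _   | yes coll = inj₁ λ _ ¬coll → contradiction coll ¬coll
    ... | yes pqr | no ¬coll = Sum.map
      (λ nz _ _ → nonZero-resp (sym (det-h s p q r)) nz)
      (λ nz _ _ → nonZero-resp (sym (det-h t p q r)) nz)
      (nonZero-affine (proj₂ (lifts pqr) ¬coll) s<t)

    encode : Fin n → Fin n → Fin n → Fin (n ℕ.* (n ℕ.* n))
    encode p q r = combine p (combine q r)

    decode : Fin (n ℕ.* (n ℕ.* n)) → Fin n × Fin n × Fin n
    decode i = Product.map₂ (remQuot n) (remQuot (n ℕ.* n) i)

    decode-encode : ∀ p q r → decode (encode p q r) ≡ (p , q , r)
    decode-encode p q r = ≡.trans
      (≡.cong (Product.map₂ (remQuot n)) (FinP.remQuot-combine p (combine q r)))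
      (≡.cong (p ,_) (FinP.remQuot-combine q r))

  module _ {P : Fin n → Set} (P? : Unary.Decidable P) (f g : Fin n → Carrier) where

    choose : Fin n → Carrier
    choose x = if does (P? x) then f x else g x

    choose-yes : ∀ {x} → P x → choose x ≈ f x
    choose-yes {x} Px = reflexive (≡.cong (if_then f x else g x) (dec-true (P? x) Px))

    choose-no : ∀ {x} → ¬ P x → choose x ≈ g x
    choose-no {x} ¬Px = reflexive (≡.cong (if_then f x else g x) (dec-false (P? x) ¬Px))

  module _ (B#0 : ∀ {p q} → p ≢ q → NonZero (B p q)) where

    -- Only the height of `x` is varied. No triple of `S` through `x` is collinear, and for such a
    -- triple the determinant of `d` is the bracket of the other two points; for the remaining
    -- triples `d` contributes nothing and `h` decides.
    addIsolated : ∀ {S x h} → Isolated S x → Lifts (S ∖ x) h → LiftsJointly S h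
                    (choose (FinP._≟ x) (λ _ → 1#) (λ _ → 0#))
    addIsolated {S} {x} {h} (x∈S , alone) lifts {p} {q} {r}
      ((p∈S , q∈S , r∈S) , (p≢q , p≢r , q≢r)) =
      cases (p FinP.≟ x) (q FinP.≟ x) (r FinP.≟ x)
      where
      d : Fin n → Carrier
      d = choose (FinP._≟ x) (λ _ → 1#) (λ _ → 0#)
      at : ∀ {y} → y ≡ x → d y ≈ 1#
      at = choose-yes (FinP._≟ x) (λ _ → 1#) (λ _ → 0#)
      off : ∀ {y} → y ≢ x → d y ≈ 0#
      off = choose-no (FinP._≟ x) (λ _ → 1#) (λ _ → 0#)
      single : ∀ {y z} → y ≢ z → NonZero (1# * B y z)
      single y≢z = nonZero-* nonZero-1 (B#0 y≢z)
      Goal : Set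
      Goal = (Coll p q r → det h p q r ≈ 0# × det d p q r ≈ 0#) ×
             (¬ Coll p q r → NonZero (det h p q r) ⊎ NonZero (det d p q r))
      cases : Dec (p ≡ x) → Dec (q ≡ x) → Dec (r ≡ x) → Goal
      cases (yes p≡x) (yes q≡x) _         = contradiction (≡.trans p≡x (≡.sym q≡x)) p≢q
      cases (yes p≡x) _         (yes r≡x) = contradiction (≡.trans p≡x (≡.sym r≡x)) p≢r
      cases _         (yes q≡x) (yes r≡x) = contradiction (≡.trans q≡x (≡.sym r≡x)) q≢r
      cases (yes ≡.refl) (no q≢x) (no r≢x) =
          (λ (l , p∈l , q∈l , _) → contradiction (alone p∈l q∈S q∈l) q≢x)
        , (λ _ → inj₂ (nonZero-resp
            (sym (trans (det-cong (at ≡.refl) (off q≢x) (off r≢x)) (combination-1 1# _ _ _)))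
            (single q≢r)))
      cases (no p≢x) (yes ≡.refl) (no r≢x) =
          (λ (l , p∈l , q∈l , _) → contradiction (alone q∈l p∈S p∈l) p≢x)
        , (λ _ → inj₂ (nonZero-resp
            (sym (trans (det-cong (off p≢x) (at ≡.refl) (off r≢x)) (combination-2 1# _ _ _)))
            (single (p≢r ∘ ≡.sym))))
      cases (no p≢x) (no q≢x) (yes ≡.refl) =
          (λ (l , p∈l , _ , r∈l) → contradiction (alone r∈l p∈S p∈l) p≢x)
        , (λ _ → inj₂ (nonZero-resp
            (sym (trans (det-cong (off p≢x) (off q≢x) (at ≡.refl)) (combination-3 1# _ _ _)))
            (single p≢q)))
      cases (no p≢x) (no q≢x) (no r≢x) =
          (λ coll → proj₁ (lifts pqr) coll
                  , trans (det-cong (off p≢x) (off q≢x) (off r≢x)) (combination-0 _ _ _))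
        , (λ ¬coll → inj₁ (proj₂ (lifts pqr) ¬coll))
        where
        pqr : Triple (S ∖ x) p q r
        pqr = ( x∈p∧x≢y⇒x∈p-y p∈S p≢x , x∈p∧x≢y⇒x∈p-y q∈S q≢x , x∈p∧x≢y⇒x∈p-y r∈S r≢x)
            , (p≢q , p≢r , q≢r)

    module _ {S l s} (s∈l : s ∈ line l)
             (only : ∀ {x m} → x ∈ S → x ∈ line l → x ≢ s → x ∈ line m → m ≢ l → OnlyOn (_∈ S) x m)
             {x₀} (x₀∈l : x₀ ∈ line l) (x₀≢s : x₀ ≢ s) where

      Removed : Fin n → Set
      Removed x = x ∈ line l × x ≢ s

      removed? : Unary.Decidable Removed
      removed? x = (x ∈? line l) ×-dec ¬? (x FinP.≟ s)

      -- On line l the heights c are linear in (u , v), and agree at s with h up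
      -- to the factor B s x₀, which makes division unnecessary.
      c : (Fin n → Carrier) → Fin n → Carrier
      c h = choose removed? (λ x → h s * B x x₀) (λ x → B s x₀ * h x)

      -- On the line this is the linear form that vanishes at `s`, so adding multiples of it bends
      -- the line about `s` and leaves all points that are kept in place.
      d : Fin n → Carrier
      d = choose removed? (B s) (λ _ → 0#)

      d-in : ∀ {x} → Removed x → d x ≈ B s x
      d-in = choose-yes removed? (B s) (λ _ → 0#)

      d-out : ∀ {x} → ¬ Removed x → d x ≈ 0#
      d-out = choose-no removed? (B s) (λ _ → 0#)

      c-line : ∀ h {x} → x ∈ line l → c h x ≈ h s * B x x₀
      c-line h {x} x∈l = cases (x FinP.≟ s)
        where
        f g : Fin n → Carrier
        f x = h s * B x x₀
        g x = B s x₀ * h x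
        cases : Dec (x ≡ s) → c h x ≈ f x
        cases (no x≢s)     = choose-yes removed? f g (x∈l , x≢s)
        cases (yes ≡.refl) = trans (choose-no removed? f g λ (_ , s≢s) → s≢s ≡.refl) (*-comm _ _)

      d-line : ∀ {x} → x ∈ line l → d x ≈ B s x
      d-line {x} x∈l = cases (x FinP.≟ s)
        where
        cases : Dec (x ≡ s) → d x ≈ B s x
        cases (no x≢s)     = d-in (x∈l , x≢s)
        cases (yes ≡.refl) = trans (d-out λ (_ , s≢s) → s≢s ≡.refl) (sym (bracket-self (u s) (v s)))

      -- A collinear triple with a removed point must lie on `l`, where `c h` and `d` are both
      -- linear forms. For a non-collinear triple with one or two removed points the determinant of
      -- `d` is a product of two nonzero brackets. Without removed points `c h` is a nonzero
      -- multiple of `h`.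
      addLeafLine : ∀ {h} → Lifts (S ─ (line l ∖ s)) h → LiftsJointly S (c h) d
      addLeafLine {h} lifts {p} {q} {r} ((p∈S , q∈S , r∈S) , (p≢q , p≢r , q≢r)) =
        cases (removed? p) (removed? q) (removed? r)
        where
        Goal : Set
        Goal = (Coll p q r → det (c h) p q r ≈ 0# × det d p q r ≈ 0#) ×
               (¬ Coll p q r → NonZero (det (c h) p q r) ⊎ NonZero (det d p q r))

        same-line : ∀ {x y m} → x ∈ S → Removed x → y ∈ S → x ≢ y →
                    x ∈ line m → y ∈ line m → m ≡ l
        same-line {x} {y} {m} x∈S (x∈l , x≢s) y∈S x≢y x∈m y∈m =
          decidable-stable (m FinP.≟ l) λ m≢l → x≢y (≡.sym (only x∈S x∈l x≢s x∈m m≢l y∈S y∈m))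

        on-line : (∀ {m} → p ∈ line m → q ∈ line m → r ∈ line m → m ≡ l) →
                  Coll p q r → det (c h) p q r ≈ 0# × det d p q r ≈ 0#
        on-line m≡l (m , p∈m , q∈m , r∈m) with m≡l p∈m q∈m r∈m
        ... | ≡.refl =
            trans (det-cong (c-line h p∈m) (c-line h q∈m) (c-line h r∈m)) (plücker-scaled _ _ _ _ _ _ _ _ _)
          , trans (det-cong (d-line p∈m) (d-line q∈m) (d-line r∈m)) (plücker _ _ _ _ _ _ _ _)

        -- Here `x` is the kept point of the triple. The other two are on `l`, so `x` is not, and
        -- hence it differs from `s`.
        off-s : ∀ {x y z} → ¬ Coll p q r → (x ∈ line l → Coll p q r) → y ≢ z → NonZero (B x s * B y z)
        off-s {x} ¬coll coll y≢z = nonZero-* (B#0 x≢s) (B#0 y≢z)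
          where
          x≢s : x ≢ s
          x≢s ≡.refl = ¬coll (coll s∈l)

        cases : Dec (Removed p) → Dec (Removed q) → Dec (Removed r) → Goal
        cases (yes p∈R) (yes q∈R) (yes r∈R) =
            on-line (λ p∈m q∈m _ → same-line p∈S p∈R q∈S p≢q p∈m q∈m)
          , (λ ¬coll → contradiction (l , proj₁ p∈R , proj₁ q∈R , proj₁ r∈R) ¬coll)
        cases (yes p∈R) (yes q∈R) (no r∉R) =
            on-line (λ p∈m q∈m _ → same-line p∈S p∈R q∈S p≢q p∈m q∈m)
          , (λ ¬coll → inj₂ (nonZero-resp
              (sym (trans (det-cong (d-in p∈R) (d-in q∈R) (d-out r∉R)) (plücker₃ _ _ _ _ _ _ _ _)))
              (off-s ¬coll (λ r∈l → l , proj₁ p∈R , proj₁ q∈R , r∈l) p≢q)))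
        cases (yes p∈R) (no q∉R) (yes r∈R) =
            on-line (λ p∈m q∈m _ → same-line p∈S p∈R q∈S p≢q p∈m q∈m)
          , (λ ¬coll → inj₂ (nonZero-resp
              (sym (trans (det-cong (d-in p∈R) (d-out q∉R) (d-in r∈R)) (plücker₂ _ _ _ _ _ _ _ _)))
              (off-s ¬coll (λ q∈l → l , proj₁ p∈R , q∈l , proj₁ r∈R) (p≢r ∘ ≡.sym))))
        cases (no p∉R) (yes q∈R) (yes r∈R) =
            on-line (λ _ q∈m r∈m → same-line q∈S q∈R r∈S q≢r q∈m r∈m)
          , (λ ¬coll → inj₂ (nonZero-resp
              (sym (trans (det-cong (d-out p∉R) (d-in q∈R) (d-in r∈R)) (plücker₁ _ _ _ _ _ _ _ _)))
              (off-s ¬coll (λ p∈l → l , p∈l , proj₁ q∈R , proj₁ r∈R) q≢r)))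
        -- A single removed point leaves one term in the determinant of `d`: its bracket with `s`
        -- times the bracket of the other two points.
        cases (yes p∈R) (no q∉R) (no r∉R) =
            on-line (λ p∈m q∈m _ → same-line p∈S p∈R q∈S p≢q p∈m q∈m)
          , (λ _ → inj₂ (nonZero-resp
              (sym (trans (det-cong (d-in p∈R) (d-out q∉R) (d-out r∉R)) (combination-1 _ _ _ _)))
              (nonZero-* (B#0 (proj₂ p∈R ∘ ≡.sym)) (B#0 q≢r))))
        cases (no p∉R) (yes q∈R) (no r∉R) =
            on-line (λ p∈m q∈m _ → same-line q∈S q∈R p∈S (p≢q ∘ ≡.sym) q∈m p∈m)
          , (λ _ → inj₂ (nonZero-resp
              (sym (trans (det-cong (d-out p∉R) (d-in q∈R) (d-out r∉R)) (combination-2 _ _ _ _)))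
              (nonZero-* (B#0 (proj₂ q∈R ∘ ≡.sym)) (B#0 (p≢r ∘ ≡.sym)))))
        cases (no p∉R) (no q∉R) (yes r∈R) =
            on-line (λ p∈m _ r∈m → same-line r∈S r∈R p∈S (p≢r ∘ ≡.sym) r∈m p∈m)
          , (λ _ → inj₂ (nonZero-resp
              (sym (trans (det-cong (d-out p∉R) (d-out q∉R) (d-in r∈R)) (combination-3 _ _ _ _)))
              (nonZero-* (B#0 (proj₂ r∈R ∘ ≡.sym)) (B#0 p≢q))))
        cases (no p∉R) (no q∉R) (no r∉R) =
            (λ coll → trans scaled (trans (*-congˡ (proj₁ (lifts pqr) coll)) (zeroʳ _))
                    , trans (det-cong (d-out p∉R) (d-out q∉R) (d-out r∉R)) (combination-0 _ _ _))
          , (λ ¬coll → inj₁ (nonZero-resp (sym scaled)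
              (nonZero-* (B#0 (x₀≢s ∘ ≡.sym)) (proj₂ (lifts pqr) ¬coll))))
          where
          c-out : ∀ {x} → ¬ Removed x → c h x ≈ B s x₀ * h x
          c-out = choose-no removed? (λ x → h s * B x x₀) (λ x → B s x₀ * h x)
          scaled : det (c h) p q r ≈ B s x₀ * det h p q r
          scaled = trans (det-cong (c-out p∉R) (c-out q∉R) (c-out r∉R)) (combination-scale _ _ _ _ _ _ _)
          keep : ∀ {x} → x ∈ S → ¬ Removed x → x ∈ S ─ (line l ∖ s)
          keep {x} x∈S x∉R = x∈p∧x∉q⇒x∈p─q x∈S λ x∈l∖s →
            x∉R (p─q⊆p (line l) ⁅ s ⁆ x∈l∖s
                , λ { ≡.refl → x∈p─q⇒x∉q (line l) ⁅ s ⁆ x∈l∖s (x∈⁅x⁆ s) })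
          pqr : Triple (S ─ (line l ∖ s)) p q r
          pqr = (keep p∈S p∉R , keep q∈S q∉R , keep r∈S r∉R) , (p≢q , p≢r , q≢r)

    ∃lifts-on : ∀ S → Acc _⊂_ S → ∃[ h ] Lifts S h
    ∃lifts-on S (acc rec) with nonempty? S
    ... | no  empty = (λ _ → 0#) , λ ((p∈S , _) , _) → contradiction (_ , p∈S) empty
    ... | yes nonempty with isolatedOrLeafLine forest S nonempty
    ...   | inj₁ (x , isolated@(x∈S , _)) =
      let h , lifts = ∃lifts-on (S ∖ x) (rec (x∈p⇒p-x⊂p x∈S))
      in generic S h _ (addIsolated isolated lifts)
    ...   | inj₂ (l , s , (s∈l , x₀ , x₀∈S , x₀∈l , x₀≢s) , only) =
      let h , lifts = ∃lifts-on (S ─ (line l ∖ s)) (rec (p∩q≢∅⇒p─q⊂p S (line l ∖ s)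
            (x₀ , x∈p∩q⁺ (x₀∈S , x∈p∧x≢y⇒x∈p-y x₀∈l x₀≢s))))
      in generic S _ _ (addLeafLine s∈l only x₀∈l x₀≢s lifts)

    ∃lifts : ∃[ h ] Lifts ⊤ h
    ∃lifts = ∃lifts-on ⊤ (⊂-wellFounded ⊤)

-- Homogeneous coordinates

module _ {n : ℕ} (C : Configuration n) where

  open Configuration C
  open Combinatorics C

  -- Fix two points of `S`. If each further point shared a line with both, these lines would all
  -- coincide by linearity and contain `S`. The bound 3 supplies a third point, through which the
  -- two fixed points acquire a common line.
  ¬collinear⇒¬coll : ∀ S → 3 ℕ.≤ ∣ S ∣ → ¬ Collinear C S →
    ∃[ p ] ∃[ q ] ∃[ r ] ((p ∈ S × q ∈ S × r ∈ S) × (p ≢ q × p ≢ r × q ≢ r) × ¬ Coll p q r)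
  ¬collinear⇒¬coll S 3≤ ¬collinear with ∃distinct₂ S 3≤
  ... | p , q , p∈S , q∈S , p≢q with FinP.any? (λ r →
          (r ∈? S) ×-dec (¬? (p FinP.≟ r) ×-dec (¬? (q FinP.≟ r) ×-dec ¬? (Coll? p q r))))
  ...   | yes (r , r∈S , p≢r , q≢r , ¬coll) =
            p , q , r , (p∈S , q∈S , r∈S) , (p≢q , p≢r , q≢r) , ¬coll
  ...   | no none = contradiction (l , λ {x} → S⊆l {x}) ¬collinear
    where
    coll : ∀ {x} → x ∈ S → p ≢ x → q ≢ x → Coll p q x
    coll {x} x∈S p≢x q≢x = decidable-stable (Coll? p q x) λ ¬coll → none (x , x∈S , p≢x , q≢x , ¬coll)
    pq-line : ∃[ l ] (p ∈ line l × q ∈ line l)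
    pq-line = let r , r∈S , p≢r , q≢r = ∃third S 3≤ p q
                  l , p∈l , q∈l , _ = coll r∈S p≢r q≢r
              in l , p∈l , q∈l
    l = proj₁ pq-line
    S⊆l : ∀ {x} → x ∈ S → x ∈ line l
    S⊆l {x} x∈S with p FinP.≟ x | q FinP.≟ x
    ... | yes ≡.refl | _          = proj₁ (proj₂ pq-line)
    ... | no  _      | yes ≡.refl = proj₂ (proj₂ pq-line)
    ... | no  p≢x    | no  q≢x    =
      let m , p∈m , q∈m , x∈m = coll x∈S p≢x q≢x
      in ≡.subst (λ k → x ∈ line k)
           (linear p≢q m l p∈m q∈m (proj₁ (proj₂ pq-line)) (proj₂ (proj₂ pq-line))) x∈m

-- The nonzero coefficient of L may sit at any index, so coordinates are taken in cyclic order
-- starting from it.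
next : Fin 3 → Fin 3
next 0F = 1F
next 1F = 2F
next 2F = 0F

cyclic-cover : ∀ i m → m ≡ i ⊎ m ≡ next i ⊎ m ≡ next (next i)
cyclic-cover 0F 0F = inj₁ ≡.refl
cyclic-cover 0F 1F = inj₂ (inj₁ ≡.refl)
cyclic-cover 0F 2F = inj₂ (inj₂ ≡.refl)
cyclic-cover 1F 0F = inj₂ (inj₂ ≡.refl)
cyclic-cover 1F 1F = inj₁ ≡.refl
cyclic-cover 1F 2F = inj₂ (inj₁ ≡.refl)
cyclic-cover 2F 0F = inj₂ (inj₁ ≡.refl)
cyclic-cover 2F 1F = inj₂ (inj₂ ≡.refl)
cyclic-cover 2F 2F = inj₁ ≡.refl

module Determinants (R : CommutativeRing 0ℓ 0ℓ) where

  open CommutativeRing R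
  open IntegerRingSolver R

  rotate : ∀ x y z → x + y + z ≈ z + x + y
  rotate = solve 3 (λ x y z → x :+ y :+ z := z :+ x :+ y) refl

  isolate : ∀ a x b y c z → a * x ≈ (a * x + b * y + c * z) + (- b * y + - c * z)
  isolate = solve 6 (λ a x b y c z →
    a :* x := (a :* x :+ b :* y :+ c :* z) :+ (:- b :* y :+ :- c :* z)) refl

  minor-homogeneous : ∀ a x y x′ y′ → a * a * (x * y′ - x′ * y) ≈ (a * x) * (a * y′) - (a * x′) * (a * y)
  minor-homogeneous = solve 5 (λ a x y x′ y′ →
    a :* a :* (x :* y′ :- x′ :* y) := (a :* x) :* (a :* y′) :- (a :* x′) :* (a :* y)) refl

  -- Multiplicativity of 2 × 2 determinants.
  minor-linear : ∀ α β α′ β′ u v u′ v′ →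
    (α * u + β * v) * (α′ * u′ + β′ * v′) - (α′ * u + β′ * v) * (α * u′ + β * v′) ≈
    (α * β′ - β * α′) * (u * v′ - v * u′)
  minor-linear = solve 8 (λ α β α′ β′ u v u′ v′ →
    (α :* u :+ β :* v) :* (α′ :* u′ :+ β′ :* v′) :- (α′ :* u :+ β′ :* v) :* (α :* u′ :+ β :* v′) :=
    (α :* β′ :- β :* α′) :* (u :* v′ :- v :* u′)) refl

  axis-minor : ∀ e u h → (u * e - h * 0#) ≈ u * e
  axis-minor = solve 3 (λ e u h → u :* e :- h :* con (+ 0) := u :* e) refl

  axis-on-ray : ∀ e u v → 0# * e + v * 0# + - u * 0# ≈ 0#
  axis-on-ray = solve 3 (λ e u v → con (+ 0) :* e :+ v :* con (+ 0) :+ (:- u) :* con (+ 0) := con (+ 0)) refl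

  point-on-ray : ∀ h u v → 0# * h + v * u + - u * v ≈ 0#
  point-on-ray = solve 3 (λ h u v → con (+ 0) :* h :+ v :* u :+ (:- u) :* v := con (+ 0)) refl

  axis-value : ∀ a b c e → a * e + b * 0# + c * 0# ≈ a * e
  axis-value = solve 4 (λ a b c e → a :* e :+ b :* con (+ 0) :+ c :* con (+ 0) := a :* e) refl

  determinant : (h₁ u₁ v₁ h₂ u₂ v₂ h₃ u₃ v₃ : Carrier) → Carrier
  determinant h₁ u₁ v₁ h₂ u₂ v₂ h₃ u₃ v₃ =
    h₁ * (u₂ * v₃ - v₂ * u₃) + h₂ * (u₃ * v₁ - v₃ * u₁) + h₃ * (u₁ * v₂ - v₁ * u₂)

  private
    Det : ∀ {k} → let P = Polynomial k in P → P → P → P → P → P → P → P → P → P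
    Det h₁ u₁ v₁ h₂ u₂ v₂ h₃ u₃ v₃ =
      h₁ :* (u₂ :* v₃ :- v₂ :* u₃) :+ h₂ :* (u₃ :* v₁ :- v₃ :* u₁) :+ h₃ :* (u₁ :* v₂ :- v₁ :* u₂)

  expand-third : ∀ h₁ u₁ v₁ h₂ u₂ v₂ h₃ u₃ v₃ →
    (u₁ * v₂ - v₁ * u₂) * h₃ + (v₁ * h₂ - h₁ * v₂) * u₃ + (h₁ * u₂ - u₁ * h₂) * v₃ ≈
    determinant h₁ u₁ v₁ h₂ u₂ v₂ h₃ u₃ v₃
  expand-third = solve 9 (λ h₁ u₁ v₁ h₂ u₂ v₂ h₃ u₃ v₃ →
    (u₁ :* v₂ :- v₁ :* u₂) :* h₃ :+ (v₁ :* h₂ :- h₁ :* v₂) :* u₃ :+ (h₁ :* u₂ :- u₁ :* h₂) :* v₃ :=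
    Det h₁ u₁ v₁ h₂ u₂ v₂ h₃ u₃ v₃) refl

  determinant-13 : ∀ h₁ u₁ v₁ h₂ u₂ v₂ → determinant h₁ u₁ v₁ h₂ u₂ v₂ h₁ u₁ v₁ ≈ 0#
  determinant-13 = solve 6 (λ h₁ u₁ v₁ h₂ u₂ v₂ → Det h₁ u₁ v₁ h₂ u₂ v₂ h₁ u₁ v₁ := con (+ 0)) refl

  determinant-23 : ∀ h₁ u₁ v₁ h₂ u₂ v₂ → determinant h₁ u₁ v₁ h₂ u₂ v₂ h₂ u₂ v₂ ≈ 0#
  determinant-23 = solve 6 (λ h₁ u₁ v₁ h₂ u₂ v₂ → Det h₁ u₁ v₁ h₂ u₂ v₂ h₂ u₂ v₂ := con (+ 0)) refl

  -- Cramer's rule without division: the values of the form at the three points are weighted by the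
  -- cofactors of the column of `a`. The two companions use the other columns.
  cramer₁ : ∀ a b c h₁ u₁ v₁ h₂ u₂ v₂ h₃ u₃ v₃ →
    a * determinant h₁ u₁ v₁ h₂ u₂ v₂ h₃ u₃ v₃ ≈
    (u₂ * v₃ - v₂ * u₃) * (a * h₁ + b * u₁ + c * v₁) +
    (u₃ * v₁ - v₃ * u₁) * (a * h₂ + b * u₂ + c * v₂) +
    (u₁ * v₂ - v₁ * u₂) * (a * h₃ + b * u₃ + c * v₃)
  cramer₁ = solve 12 (λ a b c h₁ u₁ v₁ h₂ u₂ v₂ h₃ u₃ v₃ →
    a :* Det h₁ u₁ v₁ h₂ u₂ v₂ h₃ u₃ v₃ :=
    (u₂ :* v₃ :- v₂ :* u₃) :* (a :* h₁ :+ b :* u₁ :+ c :* v₁) :+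
    (u₃ :* v₁ :- v₃ :* u₁) :* (a :* h₂ :+ b :* u₂ :+ c :* v₂) :+
    (u₁ :* v₂ :- v₁ :* u₂) :* (a :* h₃ :+ b :* u₃ :+ c :* v₃)) refl

  cramer₂ : ∀ a b c h₁ u₁ v₁ h₂ u₂ v₂ h₃ u₃ v₃ →
    b * determinant h₁ u₁ v₁ h₂ u₂ v₂ h₃ u₃ v₃ ≈
    (v₂ * h₃ - h₂ * v₃) * (a * h₁ + b * u₁ + c * v₁) +
    (v₃ * h₁ - h₃ * v₁) * (a * h₂ + b * u₂ + c * v₂) +
    (v₁ * h₂ - h₁ * v₂) * (a * h₃ + b * u₃ + c * v₃)
  cramer₂ = solve 12 (λ a b c h₁ u₁ v₁ h₂ u₂ v₂ h₃ u₃ v₃ →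
    b :* Det h₁ u₁ v₁ h₂ u₂ v₂ h₃ u₃ v₃ :=
    (v₂ :* h₃ :- h₂ :* v₃) :* (a :* h₁ :+ b :* u₁ :+ c :* v₁) :+
    (v₃ :* h₁ :- h₃ :* v₁) :* (a :* h₂ :+ b :* u₂ :+ c :* v₂) :+
    (v₁ :* h₂ :- h₁ :* v₂) :* (a :* h₃ :+ b :* u₃ :+ c :* v₃)) refl

  cramer₃ : ∀ a b c h₁ u₁ v₁ h₂ u₂ v₂ h₃ u₃ v₃ →
    c * determinant h₁ u₁ v₁ h₂ u₂ v₂ h₃ u₃ v₃ ≈
    (h₂ * u₃ - u₂ * h₃) * (a * h₁ + b * u₁ + c * v₁) +
    (h₃ * u₁ - u₃ * h₁) * (a * h₂ + b * u₂ + c * v₂) +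
    (h₁ * u₂ - u₁ * h₂) * (a * h₃ + b * u₃ + c * v₃)
  cramer₃ = solve 12 (λ a b c h₁ u₁ v₁ h₂ u₂ v₂ h₃ u₃ v₃ →
    c :* Det h₁ u₁ v₁ h₂ u₂ v₂ h₃ u₃ v₃ :=
    (h₂ :* u₃ :- u₂ :* h₃) :* (a :* h₁ :+ b :* u₁ :+ c :* v₁) :+
    (h₃ :* u₁ :- u₃ :* h₁) :* (a :* h₂ :+ b :* u₂ :+ c :* v₂) :+
    (h₁ :* u₂ :- u₁ :* h₂) :* (a :* h₃ :+ b :* u₃ :+ c :* v₃)) refl

module Coordinates (A : ApartnessRing) where

  open ApartnessRing A
  open ApartnessProperties A
  open Determinants commutativeRing
  open AbelianGroupProperties +-abelianGroup using (ε⁻¹≈ε)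

  infix 4 _♯_

  _♯_ : Carrier → Carrier → Set
  x ♯ y = NonZero (x - y)

  x-0≈x : ∀ x → x - 0# ≈ x
  x-0≈x x = trans (+-congˡ ε⁻¹≈ε) (+-identityʳ x)

  nonZero⇒♯0 : ∀ {x} → NonZero x → x ♯ 0#
  nonZero⇒♯0 = nonZero-resp (sym (x-0≈x _))

  ♯0⇒nonZero : ∀ {x} → x ♯ 0# → NonZero x
  ♯0⇒nonZero = nonZero-resp (x-0≈x _)

  Vector : Set
  Vector = Fin 3 → Carrier

  eval : Vector → Vector → Carrier
  eval a x = a 0F * x 0F + a 1F * x 1F + a 2F * x 2F

  eval-cyclic : ∀ i a x → eval a x ≈
    a i * x i + a (next i) * x (next i) + a (next (next i)) * x (next (next i))
  eval-cyclic 0F a x = refl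
  eval-cyclic 1F a x = sym (rotate _ _ _)
  eval-cyclic 2F a x = rotate _ _ _

  place : Fin 3 → (h u v : Carrier) → Vector
  place 0F h u v 0F = h
  place 0F h u v 1F = u
  place 0F h u v 2F = v
  place 1F h u v 0F = v
  place 1F h u v 1F = h
  place 1F h u v 2F = u
  place 2F h u v 0F = u
  place 2F h u v 1F = v
  place 2F h u v 2F = h

  place₀ : ∀ i h u v → place i h u v i ≡ h
  place₀ 0F h u v = ≡.refl
  place₀ 1F h u v = ≡.refl
  place₀ 2F h u v = ≡.refl

  place₁ : ∀ i h u v → place i h u v (next i) ≡ u
  place₁ 0F h u v = ≡.refl
  place₁ 1F h u v = ≡.refl
  place₁ 2F h u v = ≡.refl

  place₂ : ∀ i h u v → place i h u v (next (next i)) ≡ v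
  place₂ 0F h u v = ≡.refl
  place₂ 1F h u v = ≡.refl
  place₂ 2F h u v = ≡.refl

  eval-placeˡ : ∀ i a b c x → eval (place i a b c) x ≈ a * x i + b * x (next i) + c * x (next (next i))
  eval-placeˡ 0F a b c x = refl
  eval-placeˡ 1F a b c x = sym (rotate _ _ _)
  eval-placeˡ 2F a b c x = rotate _ _ _

  eval-placeʳ : ∀ i a h u v → eval a (place i h u v) ≈ a i * h + a (next i) * u + a (next (next i)) * v
  eval-placeʳ 0F a h u v = refl
  eval-placeʳ 1F a h u v = sym (rotate _ _ _)
  eval-placeʳ 2F a h u v = rotate _ _ _

  eval-place : ∀ i a b c h u v → eval (place i a b c) (place i h u v) ≈ a * h + b * u + c * v
  eval-place 0F a b c h u v = refl
  eval-place 1F a b c h u v = sym (rotate _ _ _)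
  eval-place 2F a b c h u v = rotate _ _ _

  -- By Cramer's rule a nonzero coefficient times the nonzero determinant is a combination of the
  -- three values, so one of these is nonzero; this also says which point is off the line.
  nonZero-someValue : ∀ i a {h₁ u₁ v₁ h₂ u₂ v₂ h₃ u₃ v₃} → (∃[ m ] a m ♯ 0#) →
    NonZero (determinant h₁ u₁ v₁ h₂ u₂ v₂ h₃ u₃ v₃) →
    eval a (place i h₁ u₁ v₁) ♯ 0# ⊎ eval a (place i h₂ u₂ v₂) ♯ 0# ⊎ eval a (place i h₃ u₃ v₃) ♯ 0#
  nonZero-someValue i a {h₁} {u₁} {v₁} {h₂} {u₂} {v₂} {h₃} {u₃} {v₃} (m , am#0) D#0 =
    Sum.map value (Sum.map value value) (cases (cyclic-cover i m))
    where
    j k : Fin 3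
    j = next i
    k = next (next i)
    form : Carrier → Carrier → Carrier → Carrier
    form h u v = a i * h + a j * u + a k * v
    D : Carrier
    D = determinant h₁ u₁ v₁ h₂ u₂ v₂ h₃ u₃ v₃
    value : ∀ {h u v} → NonZero (form h u v) → eval a (place i h u v) ♯ 0#
    value = nonZero⇒♯0 ∘ nonZero-resp (sym (eval-placeʳ i a _ _ _))
    split : ∀ {x y z α β γ} → NonZero (α * x + β * y + γ * z) → NonZero x ⊎ NonZero y ⊎ NonZero z
    split = [ Sum.map nonZero-*⁻ʳ (inj₁ ∘ nonZero-*⁻ʳ) ∘ nonZero-+ , inj₂ ∘ inj₂ ∘ nonZero-*⁻ʳ ]′ ∘ nonZero-+
    scaled : NonZero (a m * D)
    scaled = nonZero-* (♯0⇒nonZero am#0) D#0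
    cases : m ≡ i ⊎ m ≡ j ⊎ m ≡ k →
            NonZero (form h₁ u₁ v₁) ⊎ NonZero (form h₂ u₂ v₂) ⊎ NonZero (form h₃ u₃ v₃)
    cases (inj₁ ≡.refl) =
      split (nonZero-resp (cramer₁ (a i) (a j) (a k) h₁ u₁ v₁ h₂ u₂ v₂ h₃ u₃ v₃) scaled)
    cases (inj₂ (inj₁ ≡.refl)) =
      split (nonZero-resp (cramer₂ (a i) (a j) (a k) h₁ u₁ v₁ h₂ u₂ v₂ h₃ u₃ v₃) scaled)
    cases (inj₂ (inj₂ ≡.refl)) =
      split (nonZero-resp (cramer₃ (a i) (a j) (a k) h₁ u₁ v₁ h₂ u₂ v₂ h₃ u₃ v₃) scaled)

  module Chart (a : Vector) (i : Fin 3) (ai#0 : NonZero (a i)) where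

    j k : Fin 3
    j = next i
    k = next (next i)

    -- For the index `i` the equation of the line is solved for that coordinate; the factor `a i` on
    -- the left takes the place of a division.
    coordinate : ∀ m → ∃[ α ] ∃[ β ] (∀ {x} → eval a x ≈ 0# → a i * x m ≈ α * x j + β * x k)
    coordinate m = cases (cyclic-cover i m)
      where
      cases : m ≡ i ⊎ m ≡ j ⊎ m ≡ k →
              ∃[ α ] ∃[ β ] (∀ {x} → eval a x ≈ 0# → a i * x m ≈ α * x j + β * x k)
      cases (inj₁ ≡.refl) = - a j , - a k , λ {x} on → trans (isolate (a i) (x i) (a j) (x j) (a k) (x k))
        (trans (+-congʳ (trans (sym (eval-cyclic i a x)) on)) (+-identityˡ _))
      cases (inj₂ (inj₁ ≡.refl)) = a i , 0# , λ _ →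
        sym (trans (+-congˡ (zeroˡ _)) (+-identityʳ _))
      cases (inj₂ (inj₂ ≡.refl)) = 0# , a i , λ _ →
        sym (trans (+-congʳ (zeroˡ _)) (+-identityˡ _))

    chart-nonZero : ∀ {x} → eval a x ≈ 0# → (∃[ m ] x m ♯ 0#) → NonZero (x j) ⊎ NonZero (x k)
    chart-nonZero {x} on (m , xm#0) =
      let α , β , expand = coordinate m
      in Sum.map nonZero-*⁻ʳ nonZero-*⁻ʳ
           (nonZero-+ (nonZero-resp (expand on) (nonZero-* ai#0 (♯0⇒nonZero xm#0))))

    -- By `coordinate`, the square of `a i` times any minor of two points on the line is a multiple
    -- of their minor in the chart, so the chart minor inherits being nonzero.
    chart-distinct : ∀ {x y} → eval a x ≈ 0# → eval a y ≈ 0# →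
                     (∃[ m ] ∃[ m′ ] x m * y m′ ♯ x m′ * y m) → NonZero (x j * y k - x k * y j)
    chart-distinct {x} {y} on-x on-y (m , m′ , minor#0) =
      let α  , β  , expand  = coordinate m
          α′ , β′ , expand′ = coordinate m′
      in nonZero-*⁻ʳ (nonZero-resp
           (trans (minor-homogeneous (a i) (x m) (y m) (x m′) (y m′))
           (trans (+-cong (*-cong (expand on-x) (expand′ on-y)) (-‿cong (*-cong (expand′ on-x) (expand on-y))))
                  (minor-linear α β α′ β′ (x j) (x k) (y j) (y k))))
           (nonZero-* (nonZero-* ai#0 ai#0) minor#0))

-- The lifted points and their projection

module Lifting (A : ApartnessRing) {n : ℕ} (C : Configuration n) (forest : IsForest C) where

  open ApartnessRing A
  open ApartnessProperties A
  open Determinants commutativeRing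
  open Coordinates A
  open Configuration C
  open Combinatorics C

  module Realisation (y : Fin n → Fin 3 → Carrier) (a : Fin 3 → Carrier)
      (y#0 : ∀ p → ∃[ m ] y p m ♯ 0#) (i : Fin 3) (ai♯0 : a i ♯ 0#)
      (y-distinct : ∀ p q → p ≢ q → ∃[ m ] ∃[ m′ ] y p m * y q m′ ♯ y p m′ * y q m)
      (y-on : ∀ p → eval a (y p) ≈ 0#) where

    ai#0 : NonZero (a i)
    ai#0 = ♯0⇒nonZero ai♯0

    open Chart a i ai#0

    u v : Fin n → Carrier
    u p = y p j
    v p = y p k

    open Heights A C forest u v

    B#0 : ∀ {p q} → p ≢ q → NonZero (B p q)
    B#0 {p} {q} p≢q = chart-distinct (y-on p) (y-on q) (y-distinct p q p≢q)

    module Lifted (h : Fin n → Carrier) (lifts : Lifts ⊤ h) where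

      centre : Vector
      centre = place i 1# 0# 0#

      centre#0 : ∃[ m ] centre m ♯ 0#
      centre#0 = i , nonZero⇒♯0 (≡.subst NonZero (≡.sym (place₀ i 1# 0# 0#)) nonZero-1)

      centre-off : eval a centre ♯ 0#
      centre-off = nonZero⇒♯0 (nonZero-resp
        (sym (trans (eval-placeʳ i a 1# 0# 0#) (axis-value (a i) (a j) (a k) 1#)))
        (nonZero-* ai#0 nonZero-1))

      lift : Fin n → Vector
      lift p = place i (h p) (u p) (v p)

      lift#0 : ∀ p → ∃[ m ] lift p m ♯ 0#
      lift#0 p = [ (λ u#0 → j , nonZero⇒♯0 (≡.subst NonZero (≡.sym (place₁ i (h p) (u p) (v p))) u#0))
                 , (λ v#0 → k , nonZero⇒♯0 (≡.subst NonZero (≡.sym (place₂ i (h p) (u p) (v p))) v#0))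
                 ]′ (chart-nonZero (y-on p) (y#0 p))

      lift-distinct : ∀ p q → p ≢ q → ∃[ m ] ∃[ m′ ] lift p m * lift q m′ ♯ lift p m′ * lift q m
      lift-distinct p q p≢q = j , k , minor
        where
        minor : lift p j * lift q k ♯ lift p k * lift q j
        minor rewrite place₁ i (h p) (u p) (v p) | place₁ i (h q) (u q) (v q)
                    | place₂ i (h p) (u p) (v p) | place₂ i (h q) (u q) (v q) = B#0 p≢q

      lift-off-centre : ∀ p → ∃[ m ] ∃[ m′ ] lift p m * centre m′ ♯ lift p m′ * centre m
      lift-off-centre p = [ (λ u#0 → j , i , at-j u#0) , (λ v#0 → k , i , at-k v#0) ]′
        (chart-nonZero (y-on p) (y#0 p))
        where
        at-j : NonZero (u p) → lift p j * centre i ♯ lift p i * centre j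
        at-j u#0 rewrite place₀ i (h p) (u p) (v p) | place₁ i (h p) (u p) (v p)
                       | place₀ i 1# 0# 0# | place₁ i 1# 0# 0# =
          nonZero-resp (sym (axis-minor 1# (u p) (h p))) (nonZero-* u#0 nonZero-1)
        at-k : NonZero (v p) → lift p k * centre i ♯ lift p i * centre k
        at-k v#0 rewrite place₀ i (h p) (u p) (v p) | place₂ i (h p) (u p) (v p)
                       | place₀ i 1# 0# 0# | place₂ i 1# 0# 0# =
          nonZero-resp (sym (axis-minor 1# (v p) (h p))) (nonZero-* v#0 nonZero-1)

      -- The coefficient at `i` is 0, so the line passes through the centre and does not see the
      -- heights. The lift and its image differ only in coordinate `i`, hence both lie on it.
      ray : Fin n → Vector
      ray p = place i 0# (v p) (- u p)

      ray#0 : ∀ p → ∃[ m ] ray p m ♯ 0#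
      ray#0 p = [ (λ u#0 → k , nonZero⇒♯0 (≡.subst NonZero (≡.sym (place₂ i 0# (v p) (- u p))) (nonZero-neg u#0)))
                , (λ v#0 → j , nonZero⇒♯0 (≡.subst NonZero (≡.sym (place₁ i 0# (v p) (- u p))) v#0))
                ]′ (chart-nonZero (y-on p) (y#0 p))

      ray-centre : ∀ p → eval (ray p) centre ≈ 0#
      ray-centre p = trans (eval-place i 0# (v p) (- u p) 1# 0# 0#) (axis-on-ray 1# (u p) (v p))

      ray-lift : ∀ p → eval (ray p) (lift p) ≈ 0#
      ray-lift p = trans (eval-place i 0# (v p) (- u p) (h p) (u p) (v p)) (point-on-ray (h p) (u p) (v p))

      ray-image : ∀ p → eval (ray p) (y p) ≈ 0#
      ray-image p = trans (eval-placeˡ i 0# (v p) (- u p) (y p)) (point-on-ray (y p i) (u p) (v p))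

      lift-collinear : ∀ S → 3 ℕ.≤ ∣ S ∣ → Collinear C S →
        Σ[ b ∈ Vector ] ((∃[ m ] b m ♯ 0#) × (∀ p → p ∈ S → eval b (lift p) ≈ 0#))
      lift-collinear S 3≤ (l , S⊆l) =
        let p , q , p∈S , q∈S , p≢q = ∃distinct₂ S 3≤
        in through p q
         , (i , nonZero⇒♯0 (≡.subst NonZero (≡.sym (place₀ i _ _ _)) (B#0 p≢q)))
         , λ r r∈S → trans (through-value p q r) (det≈0 p∈S q∈S p≢q r r∈S)
        where
        -- The cross product of the lifts of `p` and `q`. Its entry at `i` is `B p q`, whose being
        -- nonzero makes this a line.
        through : Fin n → Fin n → Vector
        through p q = place i (B p q) (v p * h q - h p * v q) (h p * u q - u p * h q)
        through-value : ∀ p q r → eval (through p q) (lift r) ≈ det h p q r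
        through-value p q r = trans (eval-place i _ _ _ (h r) (u r) (v r))
          (expand-third (h p) (u p) (v p) (h q) (u q) (v q) (h r) (u r) (v r))
        det≈0 : ∀ {p q} → p ∈ S → q ∈ S → p ≢ q → ∀ r → r ∈ S → det h p q r ≈ 0#
        det≈0 {p} {q} p∈S q∈S p≢q r r∈S with p FinP.≟ r | q FinP.≟ r
        ... | yes ≡.refl | _          = determinant-13 (h p) (u p) (v p) (h q) (u q) (v q)
        ... | no _       | yes ≡.refl = determinant-23 (h p) (u p) (v p) (h q) (u q) (v q)
        ... | no p≢r     | no q≢r     = proj₁ (lifts ((∈⊤ , ∈⊤ , ∈⊤) , p≢q , p≢r , q≢r))
          (l , S⊆l p∈S , S⊆l q∈S , S⊆l r∈S)

      lift-nonCollinear : ∀ S → 3 ℕ.≤ ∣ S ∣ → ¬ Collinear C S →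
        ∀ b → (∃[ m ] b m ♯ 0#) → ∃[ p ] (p ∈ S × eval b (lift p) ♯ 0#)
      lift-nonCollinear S 3≤ ¬collinear b b#0 =
        let p , q , r , (p∈S , q∈S , r∈S) , distinct , ¬coll = ¬collinear⇒¬coll C S 3≤ ¬collinear
        in [ (λ off → p , p∈S , off) , [ (λ off → q , q∈S , off) , (λ off → r , r∈S , off) ]′ ]′
             (nonZero-someValue i b b#0 (proj₂ (lifts ((∈⊤ , ∈⊤ , ∈⊤) , distinct)) ¬coll))

lemma3p2 : (n : ℕ) (C : Configuration n) → IsForest C → Liftable C
lemma3p2 n C forest Y L Y-distinct Y-on = O , X , centre-off , realisation , projects
  where
  open Lifting ℂ-apartnessRing C forest
  open Realisation (λ p → ℙ².coord (Y p)) (Line.coeff L) (λ p → ℙ².nonzero (Y p))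
    (proj₁ (Line.nonzero L)) (proj₂ (Line.nonzero L)) Y-distinct Y-on
  open Heights ℂ-apartnessRing C forest u v using (∃lifts)
  open Lifted (proj₁ (∃lifts B#0)) (proj₂ (∃lifts B#0))

  O : ℙ²
  O = record { coord = centre ; nonzero = centre#0 }

  X : Fin n → ℙ²
  X p = record { coord = lift p ; nonzero = lift#0 p }

  realisation : IsNonDegenerateRealisation C X
  realisation = record
    { distinct     = lift-distinct
    ; collinear    = λ S 3≤ coll →
        let b , b#0 , on = lift-collinear S 3≤ coll in record { coeff = b ; nonzero = b#0 } , on
    ; nonCollinear = λ S 3≤ ¬coll K → lift-nonCollinear S 3≤ ¬coll (Line.coeff K) (Line.nonzero K)
    }

  projects : ∀ p → Projects O L (X p) (Y p)
  projects p = record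
    { defined = lift-off-centre p
    ; onto    = Y-on p
    ; ray     = record { coeff = ray p ; nonzero = ray#0 p }
    ; O-ray   = ray-centre p
    ; X-ray   = ray-lift p
    ; Y-ray   = ray-image p
    }
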